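{- Let $\mathfrak{X}=(X,\{R_{i}\}_{i=0}^{d})$ be a commutative association scheme (with $d\ge 2$) which is generated by a non-symmetric relation $R_{1}$ and satisfies \[R_{1}^{2}\subseteq\{R_{1},R_{1^{*}},R_{2}\},\qquad R_{1}R_{1^{*}}\subseteq\{R_{0},R_{1},R_{1^{*}},R_{2},R_{2^{*}}\},\qquad 2\notin\{1^{*},2^{*}\}.\] If $k_{1}=k_{2}>1$, then $d=4$. Moreover, if in addition $\mathfrak{X}$ is pseudocyclic, then $\mathfrak{X}$ is isomorphic to the cyclotomic scheme $\mathrm{Cyc}(13,4)$.
   Context: A $d$-class association scheme is a pair $(X,\{R_i\}_{i=0}^d)$ with $X$ finite and nonempty relations $R_i\subseteq X\times X$ such that: $R_0=\{(x,x)\mid x\in X\}$; the $R_i$ partition $X\times X$; for each $i$ there is $i^*$ with $R_i^T:=\{(y,x)\mid (x,y)\in R_i\}=R_{i^*}$; and for all $i,j,l$ the number $|R_i(x)\cap R_{j^*}(y)|$ is a constant $p^l_{i,j}$ for all $(x,y)\in R_l$, where $R(x)=\{y\mid (x,y)\in R\}$. The valency of $R_i$ is $k_i=p^0_{i,i^*}$. $R_i$ is symmetric if $i=i^*$, non-symmetric otherwise. The scheme is commutative if $p^l_{i,j}=p^l_{j,i}$ for all $i,j,l$. For nonempty subsets $E,F$ of $\{R_i\}$, $EF:=\{R_l\mid \sum_{R_i\in E}\sum_{R_j\in F}p^l_{i,j}\ne 0\}$; write $R_iR_j$ for $\{R_i\}\{R_j\}$ and $R_i^2$ for $R_iR_i$.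 A subset $F$ is closed if $R_{i^*}R_j\subseteq F$ for all $R_i,R_j\in F$; $R_j$ generates $\mathfrak{X}$ if the smallest closed subset containing $R_j$ is all of $\{R_i\}_{i=0}^d$. For a commutative scheme, the Bose–Mesner algebra (spanned by the adjacency matrices $A_i$ of the $R_i$) has a basis of primitive idempotents $E_0=J/|X|,E_1,\dots,E_d$; the multiplicities are $m_i=\operatorname{rank}E_i$, and the scheme is pseudocyclic if $m_1=\dots=m_d$. For a prime power $q$, a primitive element $\alpha$ of $\mathrm{GF}(q)$ and a divisor $d$ of $q-1$, the cyclotomic scheme $\mathrm{Cyc}(q,d)$ has point set $\mathrm{GF}(q)$, $R_0$ the diagonal, and $(x,y)\in R_i$ iff $x-y\in\alpha^i\langle\alpha^d\rangle$ for $1\le i\le d$. Two schemes are isomorphic if there is a bijection between point sets mapping each relation of one onto a relation of the other. -}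

module Defs where

open import Level using (0ℓ)
open import Data.Nat using (ℕ; zero; suc; _<_)
import Data.Nat as ℕ
open import Data.Nat.ListAction using (sum)
open import Data.Bool using (Bool; true; false; if_then_else_)
open import Data.Fin using (Fin; toℕ)
import Data.Fin as F
open import Data.List using (List; map; allFin)
open import Data.Product using (Σ; ∃; ∃-syntax; _×_; _,_)
open import Data.Sum using (_⊎_)
open import Relation.Nullary using (¬_; does)
open import Relation.Binary.PropositionalEquality using (_≡_; _≢_)
open import Algebra.Bundles using (CommutativeRing)
open import Function.Bundles using (_⤖_; _⇔_; Bijection)

count : ∀ {n} → (Fin n → Bool) → ℕ
count {n} P = sum (map (λ z → if P z then 1 else 0) (allFin n))

_=ᶠ_ : ∀ {m} → Fin m → Fin m → Bool
i =ᶠ j = does (i F.≟ j)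

_∧_ : Bool → Bool → Bool
true ∧ b = b
false ∧ b = false

-- d-class association scheme on X = Fin n.
-- The relations R_0,…,R_d are encoded by the "colour" function
-- rel : Fin n → Fin n → Fin (suc d), with (x,y) ∈ R_i iff rel x y ≡ i.
-- This encoding makes the R_i a partition of X × X automatically.

record Scheme (n d : ℕ) : Set where
  field
    rel       : Fin n → Fin n → Fin (suc d)
    rel0      : ∀ x y → rel x y ≡ F.zero → x ≡ y
    rel0'     : ∀ x → rel x x ≡ F.zero
    nonempty  : ∀ i → ∃[ x ] ∃[ y ] rel x y ≡ i
    star      : Fin (suc d) → Fin (suc d)
    transpose : ∀ x y → rel y x ≡ star (rel x y)
    p         : Fin (suc d) → Fin (suc d) → Fin (suc d) → ℕ
    p-spec    : ∀ l i j x y → rel x y ≡ l →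
                count (λ z → (rel x z =ᶠ i) ∧ (rel z y =ᶠ j)) ≡ p l i j
  -- Note |R_i(x) ∩ R_{j*}(y)| = #{z | (x,z) ∈ R_i, (z,y) ∈ R_j}.

  k : Fin (suc d) → ℕ
  k i = p F.zero i (star i)

  _∈_·_ : Fin (suc d) → Fin (suc d) → Fin (suc d) → Set
  l ∈ i · j = p l i j ≢ 0

  Closed : (Fin (suc d) → Set) → Set
  Closed E = ∀ i j l → E i → E j → l ∈ star i · j → E l

  -- R_j generates the scheme: the smallest closed subset containing R_j
  -- is everything, i.e. every closed subset containing R_j is everything.
  Generates : Fin (suc d) → Set₁
  Generates j = ∀ (E : Fin (suc d) → Set) → Closed E → E j → ∀ i → E i

  Commutative : Set
  Commutative = ∀ l i j → p l i j ≡ p l j i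

natToRing : (R : CommutativeRing 0ℓ 0ℓ) → ℕ → CommutativeRing.Carrier R
natToRing R zero = CommutativeRing.0# R
natToRing R (suc m) = CommutativeRing._+_ R (CommutativeRing.1# R) (natToRing R m)

record Char0Field : Set₁ where
  field
    cring : CommutativeRing 0ℓ 0ℓ
  open CommutativeRing cring public
  ι : ℕ → Carrier
  ι = natToRing cring
  field
    inverse : ∀ x → ¬ (x ≈ 0#) → ∃[ y ] (x * y ≈ 1#)
    nontrivial : ¬ (1# ≈ 0#)
    char0 : ∀ m → natToRing cring m ≈ 0# → m ≡ 0

module Matrices (K : Char0Field) where
  open Char0Field K

  Mat : ℕ → ℕ → Set
  Mat a b = Fin a → Fin b → Carrier

  Σ[_]_ : (m : ℕ) → (Fin m → Carrier) → Carrier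
  Σ[ zero ] f = 0#
  Σ[ suc m ] f = f F.zero + Σ[ m ] (λ i → f (F.suc i))

  _⊗_ : ∀ {a b c} → Mat a b → Mat b c → Mat a c
  (M ⊗ N) x y = Σ[ _ ] (λ z → M x z * N z y)

  _≋_ : ∀ {a b} → Mat a b → Mat a b → Set
  M ≋ N = ∀ x y → M x y ≈ N x y

  idM : ∀ {a} → Mat a a
  idM x y = if x =ᶠ y then 1# else 0#

  zeroM : ∀ {a b} → Mat a b
  zeroM _ _ = 0#

  FactorsThrough : ∀ {a b} → Mat a b → ℕ → Set
  FactorsThrough {a} {b} M r = ∃[ U ] ∃[ V ] (M ≋ (_⊗_ {a} {r} {b} U V))

  HasRank : ∀ {a b} → Mat a b → ℕ → Set
  HasRank M r = FactorsThrough M r × (∀ r' → r' < r → ¬ FactorsThrough M r')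

  module BoseMesner {n d : ℕ} (S : Scheme n d) where
    open Scheme S using (rel)

    A : Fin (suc d) → Mat n n
    A i x y = if rel x y =ᶠ i then 1# else 0#

    InBM : Mat n n → Set
    InBM M = Σ (Fin (suc d) → Carrier) λ c → (_≋_ {n} {n} M (λ x y → Σ[ suc d ] (λ i → c i * A i x y)))

    -- E_0, …, E_d is a basis of primitive idempotents of the
    -- Bose–Mesner algebra with E_0 = J/|X|:
    -- mutually orthogonal nonzero idempotents in the algebra summing to I
    -- (d+1 such elements in the (d+1)-dimensional algebra form a basis).
    record PrimitiveIdempotents (E : Fin (suc d) → Mat n n) : Set where
      field
        inBM       : ∀ i → InBM (E i)
        idem       : ∀ i → (E i ⊗ E i) ≋ E i
        orth       : ∀ i j → i ≢ j → (E i ⊗ E j) ≋ zeroM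
        nonzero    : ∀ i → ¬ (E i ≋ zeroM)
        sumId      : (λ x y → Σ[ suc d ] (λ i → E i x y)) ≋ idM
        E0         : ∀ x y → ι n * E F.zero x y ≈ 1#

-- Pseudocyclic: the multiplicities m_i = rank E_i (i ≥ 1) all coincide.
-- The primitive idempotents are taken over some field of characteristic 0
-- over which they exist (e.g. ℂ); their ranks do not depend on the choice.
Pseudocyclic : ∀ {n d} → Scheme n d → Set₁
Pseudocyclic {n} {d} S =
  ∃[ K ] ∃[ E ] ∃[ m ]
    ( Matrices.BoseMesner.PrimitiveIdempotents K S E
    × (∀ i → i ≢ F.zero → Matrices.HasRank K (E i) m))

-- The cyclotomic scheme Cyc(13,4) on GF(13) = ℤ/13 = Fin 13,
-- with primitive element α = 2:  (x,y) ∈ R_i (1 ≤ i ≤ 4) iff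
-- x - y ∈ α^i ⟨α^4⟩, i.e. x - y ≡ 2^(i + 4k) (mod 13) for some k.

CycRel : Fin 5 → Fin 13 → Fin 13 → Set
CycRel F.zero x y = x ≡ y
CycRel (F.suc i) x y =
  ∃[ t ] ((toℕ x ℕ.+ (13 ℕ.∸ toℕ y)) ℕ.% 13 ≡ (2 ℕ.^ (suc (toℕ i) ℕ.+ 4 ℕ.* t)) ℕ.% 13)

IsoCyc13-4 : ∀ {n d} → Scheme n d → Set
IsoCyc13-4 {n} {d} S =
  Σ (Fin n ⤖ Fin 13) λ f → Σ (Fin (suc d) ⤖ Fin 5) λ σ →
    ∀ x y i → (Scheme.rel S x y ≡ i) ⇔
      CycRel (Bijection.to σ i) (Bijection.to f x) (Bijection.to f y)

{-# OPTIONS --safe #-}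
-- Write A₁² = aA₁ + bA₁* + cA₂ and A₁A₁* = kI + a(A₁ + A₁*) + f(A₂ + A₂*). Comparing coefficients of A₁ and A₂ in
-- A₁²A₁* = A₁(A₁A₁*) and using row sums gives c(h + u) = fu, where h = p²₁₂* and u measures how far A₁*A₂ leaves the
-- span of I, A₁, A₁*, A₂, A₂*. If c = 0 then {R₀, R₁, R₁*} is closed; if f = 0, or if u ≠ 0, then R₁ or R₂ induces
-- on R₁(x) a tournament which is regular and transitive, hence trivial. So u = 0, the five relations form a closed
-- subset, and d = 4.
--
-- In the pseudocyclic case, ranks of idempotents equal their traces, and the two expressions of the Casimir element
-- of the Bose–Mesner algebra, by the A_j and by the E_i, show that the number of z with (z,x) and (z,y) in a common
-- relation is k - 1 for x ≠ y. This forces g = p²₁₂ = f, then a = 0, b = 2, c = f = 1, so n = 13. Finally, starting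
-- from a point x and a point of R₂(x), thirteen points are selected by existence statements, and propagating the
-- vanishing intersection numbers through all triples leaves one possible relation for each pair of them.
module Submission where

open import Defs
open import Data.Nat using (ℕ; suc; _≤_; _<_)
open import Data.Fin using (Fin; toℕ)
import Data.Fin as F
open import Data.Product using (_×_; _,_)
open import Data.Sum using (_⊎_)
open import Relation.Binary.PropositionalEquality using (_≡_; _≢_)

-- Equality in the field `K` is not assumed decidable, so elimination and zero tests are out of
-- direct reach. The linear algebra therefore lives under double negation, which is left only where
-- the goal is an equation of natural numbers. Determinants and dimension theory are avoided: a rank
-- is a minimal factorisation width, and the one matrix that has to be inverted on both sides, the
-- coefficient matrix of the E_i, is handled by an idempotent of trace zero.
--
-- The equation c(h + u) = fu is exploited by comparing c with f. If f < c, then u = h = 0, and c <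
-- f is contradictory. If c = f, then h = 0 and either u = 0 or u = 1, a = g = 0; this last family
-- is what the tournament on R₂ has to exclude.
--
-- The reconstruction is a finite constraint problem on 13 labels: four vanishing intersection
-- numbers with their symmetric images, the rule for R₀, and 23 chosen relations determine all 169
-- entries.

module FiniteSums where
  open import Data.Bool using (Bool; true; false; if_then_else_)
  open import Data.Nat using (ℕ; zero; suc; _+_; _*_; _≤_; _<_; z≤n)
  open import Data.Nat.Properties
  open import Data.List using (List; []; _∷_; map; tabulate; lookup)
  open import Data.List.Properties using (map-tabulate)
  import Data.Nat.ListAction as L
  open import Data.List.Membership.Propositional using (_∈_; _∉_)
  open import Data.List.Relation.Unary.Any using (here; there)
  open import Data.List.Relation.Unary.All as All using (All)
  open import Data.List.Membership.Propositional.Properties using (∈-lookup)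
  open import Data.List.Relation.Unary.All.Properties using (All¬⇒¬Any)
  open import Data.List.Relation.Unary.AllPairs using ([]; _∷_)
  open import Data.List.Relation.Unary.Unique.Propositional using (Unique)
  open import Data.Product using (∃-syntax; _,_)
  open import Function using (_∘_)
  open import Relation.Nullary using (yes; no; does; contradiction; Dec)
  open import Relation.Nullary.Decidable using (dec-true; dec-false)
  open import Relation.Binary.PropositionalEquality
  open import Algebra.Properties.Semiring.Sum +-*-semiring
    using (sum; sum-cong-≗; ∑-comm; ∑-distrib-+; sum-replicate-zero; *-distribˡ-sum; *-distribʳ-sum) public
  open import Data.List.Membership.DecPropositional using () renaming (_∈?_ to mem?)

  -- Finite sums of natural numbers

  𝟙 : Bool → ℕ
  𝟙 b = if b then 1 else 0

  count≡sum : ∀ {n} (P : Fin n → Bool) → count P ≡ sum (𝟙 ∘ P)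
  count≡sum P = trans (cong L.sum (map-tabulate (λ z → z) (𝟙 ∘ P))) (lemma (𝟙 ∘ P))
    where
    lemma : ∀ {n} (f : Fin n → ℕ) → L.sum (tabulate f) ≡ sum f
    lemma {zero}  f = refl
    lemma {suc n} f = cong (f F.zero +_) (lemma (f ∘ F.suc))

  𝟙-∧ : ∀ a b → 𝟙 (a ∧ b) ≡ 𝟙 a * 𝟙 b
  𝟙-∧ true  b = sym (*-identityˡ (𝟙 b))
  𝟙-∧ false b = refl

  =ᶠ-refl : ∀ {n} (i : Fin n) → (i =ᶠ i) ≡ true
  =ᶠ-refl i = dec-true (i F.≟ i) refl

  =ᶠ-≢ : ∀ {n} {i j : Fin n} → i ≢ j → (i =ᶠ j) ≡ false
  =ᶠ-≢ {i = i} {j} = dec-false (i F.≟ j)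

  sum-zero : ∀ {n} {f : Fin n → ℕ} → (∀ i → f i ≡ 0) → sum f ≡ 0
  sum-zero {n} f≡0 = trans (sum-cong-≗ f≡0) (sum-replicate-zero n)

  sum-mono-≤ : ∀ {n} {f g : Fin n → ℕ} → (∀ i → f i ≤ g i) → sum f ≤ sum g
  sum-mono-≤ {zero}  f≤g = z≤n
  sum-mono-≤ {suc n} f≤g = +-mono-≤ (f≤g F.zero) (sum-mono-≤ (f≤g ∘ F.suc))

  sum-mono-< : ∀ {n} {f g : Fin n → ℕ} (i : Fin n) → (∀ j → f j ≤ g j) → f i < g i → sum f < sum g
  sum-mono-< F.zero    f≤g f<g = +-mono-<-≤ f<g (sum-mono-≤ (f≤g ∘ F.suc))
  sum-mono-< (F.suc i) f≤g f<g = +-mono-≤-< (f≤g F.zero) (sum-mono-< i (f≤g ∘ F.suc) f<g)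

  term≤sum : ∀ {n} (f : Fin n → ℕ) i → f i ≤ sum f
  term≤sum f F.zero    = m≤m+n _ _
  term≤sum f (F.suc i) = ≤-trans (term≤sum (f ∘ F.suc) i) (m≤n+m _ _)

  sum≢0⇒∃ : ∀ {n} (f : Fin n → ℕ) → sum f ≢ 0 → ∃[ i ] f i ≢ 0
  sum≢0⇒∃ {zero}  f s≢0 = contradiction refl s≢0
  sum≢0⇒∃ {suc n} f s≢0 with f F.zero in eq
  ... | suc m = F.zero , λ f0≡0 → contradiction (trans (sym eq) f0≡0) λ ()
  ... | zero with sum≢0⇒∃ (f ∘ F.suc) s≢0
  ...   | i , fi≢0 = F.suc i , fi≢0

  sum-δ : ∀ {n} (j : Fin n) (f : Fin n → ℕ) → sum (λ i → f i * 𝟙 (j =ᶠ i)) ≡ f j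
  sum-δ {suc n} F.zero f = begin
    f F.zero * 1 + sum (λ i → f (F.suc i) * 0)  ≡⟨ cong₂ _+_ (*-identityʳ _) (sum-zero (λ i → *-zeroʳ (f (F.suc i)))) ⟩
    f F.zero + 0                                ≡⟨ +-identityʳ _ ⟩
    f F.zero                                    ∎
    where open ≡-Reasoning
  sum-δ {suc n} (F.suc j) f = begin
    f F.zero * 0 + sum (λ i → f (F.suc i) * 𝟙 (F.suc j =ᶠ F.suc i))  ≡⟨ cong₂ _+_ (*-zeroʳ (f F.zero)) (sum-δ j (f ∘ F.suc)) ⟩
    f (F.suc j)                                                      ∎
    where open ≡-Reasoning

  -- Extension by zero keeps the part of a sum outside `xs` a sum over all of `Fin n`, so that
  -- `term≤sum` applies to it.
  off : ∀ {n} → List (Fin n) → (Fin n → ℕ) → Fin n → ℕ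
  off xs f i = if does (mem? F._≟_ i xs) then 0 else f i

  off-∉ : ∀ {n} {xs : List (Fin n)} (f : Fin n → ℕ) {i} → i ∉ xs → off xs f i ≡ f i
  off-∉ {xs = xs} f {i} i∉xs = cong (if_then 0 else f i) (dec-false (mem? F._≟_ i xs) i∉xs)

  off-∈ : ∀ {n} {xs : List (Fin n)} (f : Fin n → ℕ) {i} → i ∈ xs → off xs f i ≡ 0
  off-∈ {xs = xs} f {i} i∈xs = cong (if_then 0 else f i) (dec-true (mem? F._≟_ i xs) i∈xs)

  -- Listing one more element `x` removes from `off` exactly `f x` at `x`, which `sum-δ` evaluates;
  -- uniqueness ensures that it had not been removed before.
  sum-split : ∀ {n} {xs : List (Fin n)} → Unique xs → (f : Fin n → ℕ) →
              sum f ≡ L.sum (map f xs) + sum (off xs f)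
  sum-split []             f = refl
  sum-split {xs = x ∷ xs} (x≢xs ∷ uniq) f = begin
    sum f                                                        ≡⟨ sum-split uniq f ⟩
    s + sum (off xs f)                                           ≡⟨ cong (s +_) (sum-cong-≗ pointwise) ⟩
    s + sum (λ i → f i * 𝟙 (x =ᶠ i) + off (x ∷ xs) f i)          ≡⟨ cong (s +_) (∑-distrib-+ _ (off (x ∷ xs) f)) ⟩
    s + (sum (λ i → f i * 𝟙 (x =ᶠ i)) + sum (off (x ∷ xs) f))    ≡⟨ cong (λ t → s + (t + sum (off (x ∷ xs) f))) (sum-δ x f) ⟩
    s + (f x + sum (off (x ∷ xs) f))                             ≡⟨ +-assoc s _ _ ⟨
    s + f x + sum (off (x ∷ xs) f)                               ≡⟨ cong (_+ sum (off (x ∷ xs) f)) (+-comm s _) ⟩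
    f x + s + sum (off (x ∷ xs) f)                               ∎
    where
    open ≡-Reasoning
    s = L.sum (map f xs)
    pointwise : ∀ i → off xs f i ≡ f i * 𝟙 (x =ᶠ i) + off (x ∷ xs) f i
    pointwise i with x F.≟ i
    ... | yes refl = begin
      off xs f x                  ≡⟨ off-∉ f (All¬⇒¬Any x≢xs) ⟩
      f x                         ≡⟨ *-identityʳ _ ⟨
      f x * 1                     ≡⟨ +-identityʳ _ ⟨
      f x * 1 + 0                 ≡⟨ cong (f x * 1 +_) (off-∈ {xs = x ∷ xs} f (here refl)) ⟨
      f x * 1 + off (x ∷ xs) f x  ∎
    ... | no x≢i = begin
      off xs f i                  ≡⟨ same (mem? F._≟_ i xs) ⟩
      off (x ∷ xs) f i            ≡⟨ cong (_+ off (x ∷ xs) f i) (*-zeroʳ (f i)) ⟨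
      f i * 0 + off (x ∷ xs) f i  ∎
      where
      same : Dec (i ∈ xs) → off xs f i ≡ off (x ∷ xs) f i
      same (yes i∈xs) = trans (off-∈ f i∈xs) (sym (off-∈ {xs = x ∷ xs} f (there i∈xs)))
      same (no  i∉xs) = trans (off-∉ f i∉xs) (sym (off-∉ {xs = x ∷ xs} f
        λ { (here i≡x) → x≢i (sym i≡x) ; (there i∈xs) → i∉xs i∈xs }))

  sum-supported : ∀ {n} {xs : List (Fin n)} → Unique xs → (f : Fin n → ℕ) →
                  (∀ i → i ∉ xs → f i ≡ 0) → sum f ≡ L.sum (map f xs)
  sum-supported {xs = xs} uniq f f≡0 =
    trans (sum-split uniq f) (trans (cong (L.sum (map f xs) +_) (sum-zero off≡0)) (+-identityʳ _))
    where
    off≡0 : ∀ i → off xs f i ≡ 0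
    off≡0 i with mem? F._≟_ i xs
    ... | yes _    = refl
    ... | no  i∉xs = f≡0 i i∉xs

  -- Associativity of row vector, matrix and column vector. Every regrouping of walks and triangles
  -- below is an instance.
  sum-assoc : ∀ {m n} (f : Fin m → ℕ) (g : Fin m → Fin n → ℕ) (h : Fin n → ℕ) →
              sum (λ j → sum (λ i → f i * g i j) * h j) ≡ sum (λ i → f i * sum (λ j → g i j * h j))
  sum-assoc f g h = begin
    sum (λ j → sum (λ i → f i * g i j) * h j)    ≡⟨ sum-cong-≗ (λ j → *-distribʳ-sum (h j) (λ i → f i * g i j)) ⟩
    sum (λ j → sum (λ i → f i * g i j * h j))    ≡⟨ ∑-comm (λ j i → f i * g i j * h j) ⟩
    sum (λ i → sum (λ j → f i * g i j * h j))    ≡⟨ sum-cong-≗ (λ i → sum-cong-≗ λ j → *-assoc (f i) (g i j) (h j)) ⟩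
    sum (λ i → sum (λ j → f i * (g i j * h j)))  ≡⟨ sum-cong-≗ (λ i → *-distribˡ-sum (f i) (λ j → g i j * h j)) ⟨
    sum (λ i → f i * sum (λ j → g i j * h j))    ∎
    where open ≡-Reasoning

  lookup-injective : ∀ {ℓ} {X : Set ℓ} {xs : List X} → Unique xs → ∀ {i j} → lookup xs i ≡ lookup xs j → i ≡ j
  lookup-injective (x≢ ∷ _) {F.zero}  {F.zero}  eq = refl
  lookup-injective (x≢ ∷ _) {F.zero}  {F.suc j} eq = contradiction eq (All.lookup x≢ (∈-lookup j))
  lookup-injective (x≢ ∷ _) {F.suc i} {F.zero}  eq = contradiction (sym eq) (All.lookup x≢ (∈-lookup i))
  lookup-injective (_ ∷ u)  {F.suc i} {F.suc j} eq = cong F.suc (lookup-injective u eq)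

-- Intersection numbers of association schemes

module SchemeTheory where
  open FiniteSums
  open import Data.Bool using (true; false)
  open import Data.Nat using (ℕ; zero; suc; _*_; _≤_; _<_; z≤n; s≤s)
  open import Data.Nat.Properties
  open import Data.Product using (∃-syntax; _×_; _,_)
  open import Data.Sum using (_⊎_; inj₁; inj₂)
  open import Function using (_∘_)
  open import Relation.Nullary using (yes; no; contradiction)
  open import Relation.Nullary.Decidable using (decidable-stable)
  open import Relation.Binary.PropositionalEquality

  module SchemeProperties {n d : ℕ} (S : Scheme n d) where
    open Scheme S
    open ≡-Reasoning

    -- The adjacency matrix of R_i over ℕ, which turns counting into sums of products.
    R : Fin (suc d) → Fin n → Fin n → ℕ
    R i x y = 𝟙 (rel x y =ᶠ i)

    R-≡ : ∀ {i x y} → rel x y ≡ i → R i x y ≡ 1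
    R-≡ {i} refl = cong 𝟙 (=ᶠ-refl i)

    R-≢ : ∀ {i x y} → rel x y ≢ i → R i x y ≡ 0
    R-≢ = cong 𝟙 ∘ =ᶠ-≢

    R-≢0 : ∀ {i x y} → R i x y ≢ 0 → rel x y ≡ i
    R-≢0 {i} {x} {y} R≢0 = decidable-stable (rel x y F.≟ i) (R≢0 ∘ R-≢)

    star-involutive : ∀ i → star (star i) ≡ i
    star-involutive i with nonempty i
    ... | x , y , refl = trans (sym (cong star (transpose x y))) (sym (transpose y x))

    star-zero : star F.zero ≡ F.zero
    star-zero with nonempty F.zero
    ... | x , _ , _ = trans (cong star (sym (rel0' x))) (trans (sym (transpose x x)) (rel0' x))

    R-star : ∀ i x y → R (star i) y x ≡ R i x y
    R-star i x y with rel x y F.≟ i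
    ... | yes refl = R-≡ (transpose x y)
    ... | no  ≢i = R-≢ λ eq → ≢i (trans (transpose y x) (trans (cong star eq) (star-involutive i)))

    sum-R : ∀ (g : Fin (suc d) → ℕ) x y → sum (λ m → g m * R m x y) ≡ g (rel x y)
    sum-R g x y = sum-δ (rel x y) g

    R-subst : ∀ (g : Fin (suc d) → ℕ) l x y → R l x y * g (rel x y) ≡ R l x y * g l
    R-subst g l x y with rel x y F.≟ l
    ... | yes refl = refl
    ... | no _     = refl

    paths : ∀ i j x y → sum (λ z → R i x z * R j z y) ≡ p (rel x y) i j
    paths i j x y = begin
      sum (λ z → R i x z * R j z y)                          ≡⟨ sum-cong-≗ (λ z → 𝟙-∧ (rel x z =ᶠ i) _) ⟨
      sum (λ z → 𝟙 ((rel x z =ᶠ i) ∧ (rel z y =ᶠ j)))        ≡⟨ count≡sum (λ z → (rel x z =ᶠ i) ∧ (rel z y =ᶠ j)) ⟨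
      count (λ z → (rel x z =ᶠ i) ∧ (rel z y =ᶠ j))          ≡⟨ p-spec _ i j x y refl ⟩
      p (rel x y) i j                                        ∎

    path-≢0 : ∀ {x y z i j l} → rel x y ≡ l → rel x z ≡ i → rel z y ≡ j → l ∈ i · j
    path-≢0 {x} {y} {z} {i} {j} refl xz zy p≡0 = contradiction one≤zero λ ()
      where
      one≤zero : 1 ≤ 0
      one≤zero = subst₂ _≤_ (cong₂ _*_ (R-≡ xz) (R-≡ zy)) (trans (paths i j x y) p≡0)
                   (term≤sum (λ z → R i x z * R j z y) z)

    path-∃ : ∀ {x y i j l} → rel x y ≡ l → l ∈ i · j → ∃[ z ] (rel x z ≡ i × rel z y ≡ j)
    path-∃ {x} {y} {i} {j} refl p≢0 with sum≢0⇒∃ (λ z → R i x z * R j z y) (p≢0 ∘ trans (sym (paths i j x y)))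
    ... | z , ≢0 = z , R-≢0 (λ eq → ≢0 (cong (_* R j z y) eq))
                     , R-≢0 (λ eq → ≢0 (trans (cong (R i x z *_) eq) (*-zeroʳ (R i x z))))

    p-transpose : ∀ l i j → p (star l) (star j) (star i) ≡ p l i j
    p-transpose l i j with nonempty l
    ... | x , y , refl = begin
      p (star (rel x y)) (star j) (star i)               ≡⟨ cong (λ l → p l (star j) (star i)) (transpose x y) ⟨
      p (rel y x) (star j) (star i)                      ≡⟨ paths (star j) (star i) y x ⟨
      sum (λ z → R (star j) y z * R (star i) z x)        ≡⟨ sum-cong-≗ (λ z → trans (cong₂ _*_ (R-star j z y) (R-star i x z)) (*-comm (R j z y) _)) ⟩
      sum (λ z → R i x z * R j z y)                      ≡⟨ paths i j x y ⟩
      p (rel x y) i j                                    ∎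

    valency : ∀ i x → sum (λ z → R i x z) ≡ k i
    valency i x = begin
      sum (λ z → R i x z)                      ≡⟨ sum-cong-≗ (λ z → trans (idem (rel x z =ᶠ i)) (cong (R i x z *_) (sym (R-star i x z)))) ⟩
      sum (λ z → R i x z * R (star i) z x)     ≡⟨ paths i (star i) x x ⟩
      p (rel x x) i (star i)                   ≡⟨ cong (λ l → p l i (star i)) (rel0' x) ⟩
      k i                                      ∎
      where
      idem : ∀ b → 𝟙 b ≡ 𝟙 b * 𝟙 b
      idem true  = refl
      idem false = refl

    sum-valencies : sum k ≡ n
    sum-valencies with nonempty F.zero
    ... | x , _ , _ = begin
      sum k                                   ≡⟨ sum-cong-≗ (λ i → valency i x) ⟨
      sum (λ i → sum (λ z → R i x z))         ≡⟨ ∑-comm (λ i z → R i x z) ⟩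
      sum (λ z → sum (λ i → R i x z))         ≡⟨ sum-cong-≗ (λ z → trans (sum-cong-≗ λ i → sym (*-identityˡ (R i x z))) (sum-R (λ _ → 1) x z)) ⟩
      sum {n} (λ _ → 1)                       ≡⟨ ones n ⟩
      n                                       ∎
      where
      ones : ∀ m → sum {m} (λ _ → 1) ≡ m
      ones zero    = refl
      ones (suc m) = cong suc (ones m)

    valency-pos : ∀ i → k i ≢ 0
    valency-pos i ki≡0 with nonempty i
    ... | x , y , xy = path-≢0 {z = y} (rel0' x) xy (trans (transpose x y) (cong star xy)) ki≡0

    p-zeroʳ : ∀ l → p l l F.zero ≡ 1
    p-zeroʳ l with nonempty l
    ... | x , y , refl = begin
      p (rel x y) (rel x y) F.zero                        ≡⟨ paths (rel x y) F.zero x y ⟨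
      sum (λ z → R (rel x y) x z * R F.zero z y)          ≡⟨ sum-cong-≗ (λ z → cong (R (rel x y) x z *_) (cong 𝟙 (diag z))) ⟩
      sum (λ z → R (rel x y) x z * 𝟙 (y =ᶠ z))            ≡⟨ sum-δ y (R (rel x y) x) ⟩
      R (rel x y) x y                                     ≡⟨ R-≡ refl ⟩
      1                                                   ∎
      where
      diag : ∀ z → (rel z y =ᶠ F.zero) ≡ (y =ᶠ z)
      diag z with y F.≟ z
      ... | yes refl = trans (cong (_=ᶠ F.zero) (rel0' y)) (=ᶠ-refl {suc d} F.zero)
      ... | no  y≢z  = =ᶠ-≢ (λ eq → y≢z (sym (rel0 z y eq)))

    p-zeroʳ-≢ : ∀ {l i} → l ≢ i → p l i F.zero ≡ 0
    p-zeroʳ-≢ {l} {i} l≢i with nonempty l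
    ... | x , y , xy = decidable-stable (_ ≟ 0) λ p≢0 → let z , xz , zy = path-∃ xy p≢0 in
      l≢i (trans (sym xy) (trans (cong (rel x) (sym (rel0 z y zy))) xz))

    k-zero : k F.zero ≡ 1
    k-zero = trans (cong (p F.zero F.zero) star-zero) (p-zeroʳ F.zero)

    p-row : ∀ l i → sum (λ j → p l i j) ≡ k i
    p-row l i with nonempty l
    ... | x , y , refl = begin
      sum (λ j → p (rel x y) i j)                        ≡⟨ sum-cong-≗ (λ j → paths i j x y) ⟨
      sum (λ j → sum (λ z → R i x z * R j z y))          ≡⟨ ∑-comm (λ j z → R i x z * R j z y) ⟩
      sum (λ z → sum (λ j → R i x z * R j z y))          ≡⟨ sum-cong-≗ (λ z → sum-R (λ _ → R i x z) z y) ⟩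
      sum (λ z → R i x z)                                ≡⟨ valency i x ⟩
      k i                                                ∎

    -- Both sides count the triangles on a given point x with sides R_i, R_j, R_l.
    p-shift-weighted : ∀ l i j → k l * p l i j ≡ k i * p i l (star j)
    p-shift-weighted l i j with nonempty F.zero
    ... | x , _ , _ = begin
      k l * p l i j                                              ≡⟨ side l i j ⟨
      sum (λ y → R l x y * sum (λ z → R i x z * R j z y))        ≡⟨ sum-cong-≗ (λ y → cong (R l x y *_) (sum-cong-≗ λ z → trans (*-comm (R i x z) (R j z y)) (cong (_* R i x z) (sym (R-star j z y))))) ⟩
      sum (λ y → R l x y * sum (λ z → R (star j) y z * R i x z)) ≡⟨ sum-assoc (R l x) (R (star j)) (R i x) ⟨
      sum (λ z → sum (λ y → R l x y * R (star j) y z) * R i x z) ≡⟨ sum-cong-≗ (λ z → *-comm (sum (λ y → R l x y * R (star j) y z)) (R i x z)) ⟩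
      sum (λ z → R i x z * sum (λ y → R l x y * R (star j) y z)) ≡⟨ side i l (star j) ⟩
      k i * p i l (star j)                                       ∎
      where
      side : ∀ l i j → sum (λ y → R l x y * sum (λ z → R i x z * R j z y)) ≡ k l * p l i j
      side l i j = begin
        sum (λ y → R l x y * sum (λ z → R i x z * R j z y))    ≡⟨ sum-cong-≗ (λ y → trans (cong (R l x y *_) (paths i j x y)) (R-subst (λ l → p l i j) l x y)) ⟩
        sum (λ y → R l x y * p l i j)                          ≡⟨ *-distribʳ-sum (p l i j) (R l x) ⟨
        sum (λ y → R l x y) * p l i j                          ≡⟨ cong (_* p l i j) (valency l x) ⟩
        k l * p l i j                                          ∎

    -- For a pair of R_l, both sides count the walks of three steps of types i, j, h; the first two
    -- steps are merged on the left, the last two on the right.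
    p-assoc : ∀ i j h l → sum (λ m → p m i j * p l m h) ≡ sum (λ m → p m j h * p l i m)
    p-assoc i j h l with nonempty l
    ... | x , y , refl = begin
      sum (λ m → p m i j * p (rel x y) m h)                    ≡⟨ sum-cong-≗ (λ m → cong (p m i j *_) (paths m h x y)) ⟨
      sum (λ m → p m i j * sum (λ z → R m x z * R h z y))      ≡⟨ sum-assoc (λ m → p m i j) (λ m z → R m x z) (λ z → R h z y) ⟨
      sum (λ z → sum (λ m → p m i j * R m x z) * R h z y)      ≡⟨ sum-cong-≗ (λ z → cong (_* R h z y) (trans (sum-R (λ m → p m i j) x z) (sym (paths i j x z)))) ⟩
      sum (λ z → sum (λ w → R i x w * R j w z) * R h z y)      ≡⟨ sum-assoc (R i x) (R j) (λ z → R h z y) ⟩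
      sum (λ w → R i x w * sum (λ z → R j w z * R h z y))      ≡⟨ sum-cong-≗ (λ w → cong (R i x w *_) (trans (paths j h w y) (sym (sum-R (λ m → p m j h) w y)))) ⟩
      sum (λ w → R i x w * sum (λ m → p m j h * R m w y))      ≡⟨ sum-cong-≗ (λ w → cong (R i x w *_) (sum-cong-≗ λ m → *-comm (p m j h) (R m w y))) ⟩
      sum (λ w → R i x w * sum (λ m → R m w y * p m j h))      ≡⟨ sum-assoc (R i x) (λ w m → R m w y) (λ m → p m j h) ⟨
      sum (λ m → sum (λ w → R i x w * R m w y) * p m j h)      ≡⟨ sum-cong-≗ (λ m → trans (*-comm (sum (λ w → R i x w * R m w y)) (p m j h)) (cong (p m j h *_) (paths i m x y))) ⟩
      sum (λ m → p m j h * p (rel x y) i m)                    ∎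

    -- Under these hypotheses R_j induces on R_i(x) a tournament without directed 3-cycles,
    -- that is a transitive one, which is moreover regular; so it has no arcs.
    transitive-regular : ∀ {i j} → star j ≢ j → p (star j) j j ≡ 0 →
      (∀ l → l ∈ star i · i → l ≡ F.zero ⊎ l ≡ j ⊎ l ≡ star j) → p i i (star j) ≡ 0
    transitive-regular {i} {j} j*≢j acyclic tournament with p i i (star j) in eq
    ... | zero  = refl
    ... | suc q with nonempty i
    ...   | x , y , xy with path-∃ {j = star j} xy (λ p≡0 → contradiction (trans (sym eq) p≡0) λ ())
    -- Read R_j* as arcs. Since z → y, transitivity sends every arc into `z` to an arc into `y`, and
    -- `z` itself precedes `y` but not `z`. So the in-degrees of `z` and `y` differ, against
    -- regularity.
    ...     | z , xz , zy = contradiction (trans (degree xz) (sym (degree xy))) (<⇒≢ (sum-mono-< z nested strict))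
      where
      degree : ∀ {v} → rel x v ≡ i → sum (λ w → R i x w * R (star j) w v) ≡ suc q
      degree {v} xv = trans (paths i (star j) x v) (trans (cong (λ l → p l i (star j)) xv) eq)
      j*≢0 : star j ≢ F.zero
      j*≢0 j*≡0 = j*≢j (trans j*≡0 (sym (trans (sym (star-involutive j)) (trans (cong star j*≡0) star-zero))))
      arc : ∀ {w} → rel x w ≡ i → rel w z ≡ star j → rel w y ≡ star j
      arc {w} xw wz with tournament (rel w y) (path-≢0 refl (trans (transpose x w) (cong star xw)) xy)
      ... | inj₂ (inj₂ wy) = wy
      ... | inj₂ (inj₁ wy) = contradiction acyclic
        (path-≢0 wz wy (trans (transpose z y) (trans (cong star zy) (star-involutive j))))
      ... | inj₁ wy with rel0 w y wy
      ...   | refl = contradiction (trans (sym (star-involutive j)) (trans (sym (trans (transpose z y) (cong star zy))) wz)) (j*≢j ∘ sym)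
      nested : ∀ w → R i x w * R (star j) w z ≤ R i x w * R (star j) w y
      nested w with rel x w F.≟ i | rel w z F.≟ star j
      ... | no _   | _      = z≤n
      ... | yes _  | no _   = z≤n
      ... | yes xw | yes wz = ≤-reflexive (sym (cong (1 *_) (R-≡ (arc xw wz))))
      strict : R i x z * R (star j) z z < R i x z * R (star j) z y
      strict = subst₂ _<_
        (sym (trans (cong (R i x z *_) (R-≢ λ zz → j*≢0 (trans (sym zz) (rel0' z)))) (*-zeroʳ (R i x z))))
        (sym (cong₂ _*_ (R-≡ xz) (R-≡ zy))) (s≤s z≤n)

-- Arithmetic of the parameters

module Arithmetic where
  open import Data.Nat using (ℕ; zero; suc; _+_; _*_; _≤_; _<_; ≢-nonZero)
  open import Data.Nat.Properties
  open import Data.Nat.Tactic.RingSolver using (solve-∀)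
  open import Data.Product using (_×_; _,_; proj₁; proj₂)
  open import Data.Sum using (_⊎_; inj₁; inj₂)
  open import Relation.Nullary using (contradiction)
  open import Relation.Binary.PropositionalEquality
  open import Relation.Binary.Definitions using (tri<; tri≈; tri>)

  square≡0 : ∀ {x} → x * x ≡ 0 → x ≡ 0
  square≡0 {zero} _ = refl

  -- Otherwise fu < cu ≤ c(h + u). It is also applied with the roles of c and f exchanged, and with
  -- g in place of u.
  larger-multiplier : ∀ {c f} h u → f < c → c * (h + u) ≤ f * u → u ≡ 0
  larger-multiplier     h zero    f<c le = refl
  larger-multiplier {c} h (suc u) f<c le = contradiction le
    (<⇒≱ (<-≤-trans (*-monoˡ-< (suc u) f<c) (*-monoʳ-≤ c (m≤n+m _ h))))

  -- The equations satisfied by a = p¹₁₁, b = p¹*₁₁, c = p²₁₁, f = p²₁₁*, g = p²₁₂, h = p²₁₂*, k = k₁ and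
  -- u, the sum of p²₁ₗ over the R_l other than R₀, R₁, R₁*, R₂, R₂*: row sums of intersection matrices,
  -- and the coefficients of A₁ and A₂ in (A₁A₁)A₁* = A₁(A₁A₁*).
  module Parameters {a b c f g h u k : ℕ}
    (row* : k ≡ a + b + c) (row : k ≡ 1 + (a + a + f + f)) (row₂ : k ≡ c + f + g + h + u)
    (assoc₁ : a * a + b * b + c * c ≡ k + a * a + a * a + f * f + f * f)
    (assoc₂ : a * f + c * g ≡ a * c + a * f + f * g + f * h)
    where
    open ≡-Reasoning

    b+c : b + c ≡ 1 + a + f + f
    b+c = +-cancelˡ-≡ a _ _ (begin
      a + (b + c)           ≡⟨ +-assoc a b c ⟨
      a + b + c             ≡⟨ row* ⟨
      k                     ≡⟨ row ⟩
      1 + (a + a + f + f)   ≡⟨ ring a f ⟩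
      a + (1 + a + f + f)   ∎)
      where
      ring : ∀ a f → 1 + (a + a + f + f) ≡ a + (1 + a + f + f)
      ring = solve-∀

    c+g+h+u : c + g + h + u ≡ 1 + a + a + f
    c+g+h+u = +-cancelˡ-≡ f _ _ (begin
      f + (c + g + h + u)   ≡⟨ ring₁ c f g h u ⟩
      c + f + g + h + u     ≡⟨ row₂ ⟨
      k                     ≡⟨ row ⟩
      1 + (a + a + f + f)   ≡⟨ ring₂ a f ⟩
      f + (1 + a + a + f)   ∎)
      where
      ring₁ : ∀ c f g h u → f + (c + g + h + u) ≡ c + f + g + h + u
      ring₁ = solve-∀
      ring₂ : ∀ a f → 1 + (a + a + f + f) ≡ f + (1 + a + a + f)
      ring₂ = solve-∀

    c*g : c * g ≡ a * c + f * g + f * h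
    c*g = +-cancelˡ-≡ (a * f) _ _ (trans assoc₂ (ring (a * c) (a * f) (f * g) (f * h)))
      where
      ring : ∀ x y z w → x + y + z + w ≡ y + (x + z + w)
      ring = solve-∀

    -- The squares in `assoc₁` are those in the square of `b+c`; removing them leaves the mixed term
    -- 2bc.
    b*c : b * c ≡ f + 2 * (a * f) + f * f
    b*c = *-cancelˡ-≡ _ _ 2 (+-cancelʳ-≡ (a * a + b * b + c * c) _ _ (begin
      2 * (b * c) + (a * a + b * b + c * c)                     ≡⟨ ring₁ a b c ⟩
      a * a + (b + c) * (b + c)                                 ≡⟨ cong (λ t → a * a + t * t) b+c ⟩
      a * a + (1 + a + f + f) * (1 + a + f + f)                 ≡⟨ ring₂ a f ⟩
      2 * (f + 2 * (a * f) + f * f) + (1 + (a + a + f + f) + a * a + a * a + f * f + f * f)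
                                                                ≡⟨ cong (λ k → 2 * (f + 2 * (a * f) + f * f) + (k + a * a + a * a + f * f + f * f)) row ⟨
      2 * (f + 2 * (a * f) + f * f) + (k + a * a + a * a + f * f + f * f) ≡⟨ cong (2 * (f + 2 * (a * f) + f * f) +_) assoc₁ ⟨
      2 * (f + 2 * (a * f) + f * f) + (a * a + b * b + c * c)   ∎))
      where
      ring₁ : ∀ a b c → 2 * (b * c) + (a * a + b * b + c * c) ≡ a * a + (b + c) * (b + c)
      ring₁ = solve-∀
      ring₂ : ∀ a f → a * a + (1 + a + f + f) * (1 + a + f + f)
            ≡ 2 * (f + 2 * (a * f) + f * f) + (1 + (a + a + f + f) + a * a + a * a + f * f + f * f)
      ring₂ = solve-∀

    -- `b*c` says bc = f(1 + 2a + f), which is f times the row sum `c+g+h+u`. Compare this with c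
    -- times the same row sum, eliminating b by `b+c` and cg by `c*g`: all terms cancel except c(h +
    -- u) and fu.
    c*[h+u] : c * (h + u) ≡ f * u
    c*[h+u] = +-cancelʳ-≡ (c * c + (a * c + f * g + f * h) + f * c) _ _ (begin
      c * (h + u) + (c * c + (a * c + f * g + f * h) + f * c)   ≡⟨ cong (λ t → c * (h + u) + (c * c + t + f * c)) c*g ⟨
      c * (h + u) + (c * c + c * g + f * c)                     ≡⟨ ring₁ c f g h u ⟩
      c * (c + g + h + u) + f * c                               ≡⟨ cong (λ t → c * t + f * c) c+g+h+u ⟩
      c * (1 + a + a + f) + f * c                               ≡⟨ ring₂ a c f ⟩
      (1 + a + f + f) * c + a * c                               ≡⟨ cong (λ t → t * c + a * c) b+c ⟨
      (b + c) * c + a * c                                       ≡⟨ ring₃ a b c ⟩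
      b * c + (c * c + a * c)                                   ≡⟨ cong (_+ (c * c + a * c)) b*c ⟩
      f + 2 * (a * f) + f * f + (c * c + a * c)                 ≡⟨ ring₄ f a (c * c + a * c) ⟩
      f * (1 + a + a + f) + (c * c + a * c)                     ≡⟨ cong (λ t → f * t + (c * c + a * c)) c+g+h+u ⟨
      f * (c + g + h + u) + (c * c + a * c)                     ≡⟨ ring₅ a c f g h u ⟩
      f * u + (c * c + (a * c + f * g + f * h) + f * c)         ∎)
      where
      ring₁ : ∀ c f g h u → c * (h + u) + (c * c + c * g + f * c) ≡ c * (c + g + h + u) + f * c
      ring₁ = solve-∀
      ring₂ : ∀ a c f → c * (1 + a + a + f) + f * c ≡ (1 + a + f + f) * c + a * c
      ring₂ = solve-∀
      ring₃ : ∀ a b c → (b + c) * c + a * c ≡ b * c + (c * c + a * c)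
      ring₃ = solve-∀
      ring₄ : ∀ f a x → f + 2 * (a * f) + f * f + x ≡ f * (1 + a + a + f) + x
      ring₄ = solve-∀
      ring₅ : ∀ a c f g h u → f * (c + g + h + u) + (c * c + a * c) ≡ f * u + (c * c + (a * c + f * g + f * h) + f * c)
      ring₅ = solve-∀

    -- If f < c, then `c*[h+u]` gives u = 0 and then h = 0. If c = f, it gives h = 0, `c*g` gives a
    -- = 0, and the row sum becomes g + u = 1. If c < f, then `c*g` gives g = 0 and hence a = h = 0,
    -- `c*[h+u]` gives u = 0, and the row sum becomes c = 1 + f, which is absurd.
    dichotomy : c ≢ 0 → f ≢ 0 → h ≡ 0 × (u ≡ 0 ⊎ (c ≡ f × a ≡ 0 × g ≡ 0))
    dichotomy c≢0 f≢0 with <-cmp c f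
    ... | tri> _ _ f<c = m+n≡0⇒m≡0 h h+u≡0 , inj₁ u≡0
      where
      u≡0 : u ≡ 0
      u≡0 = larger-multiplier h u f<c (≤-reflexive c*[h+u])
      h+u≡0 : h + u ≡ 0
      h+u≡0 = *-cancelˡ-≡ _ _ c {{≢-nonZero c≢0}} (trans c*[h+u] (trans (cong (f *_) u≡0) (trans (*-zeroʳ f) (sym (*-zeroʳ c)))))
    ... | tri≈ _ c≡f _ = h≡0 , u-or-g u refl
      where
      h≡0 : h ≡ 0
      h≡0 = *-cancelˡ-≡ _ _ c {{≢-nonZero c≢0}} (+-cancelʳ-≡ (c * u) _ _ (begin
        c * h + c * u    ≡⟨ *-distribˡ-+ c h u ⟨
        c * (h + u)      ≡⟨ c*[h+u] ⟩
        f * u            ≡⟨ cong (_* u) c≡f ⟨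
        c * u            ≡⟨ cong (_+ c * u) (*-zeroʳ c) ⟨
        c * 0 + c * u    ∎))
      a≡0 : a ≡ 0
      a≡0 = *-cancelʳ-≡ _ _ c {{≢-nonZero c≢0}} (m+n≡0⇒m≡0 _ (+-cancelʳ-≡ (c * g) (a * c + f * h) 0 (begin
        a * c + f * h + c * g    ≡⟨ cong (λ c → a * c + f * h + c * g) c≡f ⟩
        a * f + f * h + f * g    ≡⟨ ring (a * f) (f * g) (f * h) ⟩
        a * f + f * g + f * h    ≡⟨ cong (λ c → a * c + f * g + f * h) c≡f ⟨
        a * c + f * g + f * h    ≡⟨ c*g ⟨
        c * g                    ∎)))
        where
        ring : ∀ x y z → x + z + y ≡ x + y + z
        ring = solve-∀
      u-or-g : ∀ v → u ≡ v → u ≡ 0 ⊎ (c ≡ f × a ≡ 0 × g ≡ 0)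
      u-or-g zero    u≡0 = inj₁ u≡0
      u-or-g (suc v) u≡1+v = inj₂ (c≡f , a≡0 , m+n≡0⇒m≡0 g (suc-injective (+-cancelˡ-≡ c _ 1 (begin
        c + suc (g + (h + v))    ≡⟨ ring c g h v ⟩
        c + g + h + suc v        ≡⟨ cong (c + g + h +_) u≡1+v ⟨
        c + g + h + u            ≡⟨ c+g+h+u ⟩
        1 + a + a + f            ≡⟨ cong₂ (λ a f → 1 + a + a + f) a≡0 (sym c≡f) ⟩
        1 + c                    ≡⟨ +-comm 1 c ⟩
        c + 1                    ∎))))
        where
        ring : ∀ c g h v → c + suc (g + (h + v)) ≡ c + g + h + suc v
        ring = solve-∀
    ... | tri< c<f _ _ = contradiction c≡1+f (λ c≡1+f → <-asym c<f (subst (f <_) (sym c≡1+f) (n<1+n f)))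
      where
      g≡0 : g ≡ 0
      g≡0 = larger-multiplier 0 g c<f (≤-trans (≤-trans (m≤n+m _ (a * c)) (m≤m+n _ _)) (≤-reflexive (sym c*g)))
      z : a * c + f * g + f * h ≡ 0
      z = trans (sym c*g) (trans (cong (c *_) g≡0) (*-zeroʳ c))
      a≡0 : a ≡ 0
      a≡0 = *-cancelʳ-≡ _ _ c {{≢-nonZero c≢0}} (m+n≡0⇒m≡0 _ (m+n≡0⇒m≡0 _ z))
      h≡0 : h ≡ 0
      h≡0 = *-cancelˡ-≡ _ _ f {{≢-nonZero f≢0}} (trans (m+n≡0⇒n≡0 (a * c + f * g) z) (sym (*-zeroʳ f)))
      u≡0 : u ≡ 0
      u≡0 = larger-multiplier 0 u c<f (≤-reflexive (trans (sym c*[h+u]) (cong (λ h → c * (h + u)) h≡0)))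
      c≡1+f : c ≡ 1 + f
      c≡1+f = begin
        c                      ≡⟨ ring c ⟩
        c + 0 + 0 + 0          ≡⟨ cong₂ (λ x y → c + 0 + x + y) h≡0 u≡0 ⟨
        c + 0 + h + u          ≡⟨ cong (λ x → c + x + h + u) g≡0 ⟨
        c + g + h + u          ≡⟨ c+g+h+u ⟩
        1 + a + a + f          ≡⟨ cong (λ a → 1 + a + a + f) a≡0 ⟩
        1 + f                  ∎
        where
        ring : ∀ c → c ≡ c + 0 + 0 + 0
        ring = solve-∀

    f≡0⇒b≡0 : c ≢ 0 → f ≡ 0 → b ≡ 0
    f≡0⇒b≡0 c≢0 f≡0 = *-cancelʳ-≡ _ _ c {{≢-nonZero c≢0}} (trans b*c (trans
      (cong (λ f → f + 2 * (a * f) + f * f) f≡0) (ring a)))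
      where
      ring : ∀ a → 0 + 2 * (a * 0) + 0 * 0 ≡ 0
      ring = solve-∀

    c≡0⇒f≡0 : c ≡ 0 → f ≡ 0
    c≡0⇒f≡0 c≡0 = m+n≡0⇒m≡0 f (m+n≡0⇒m≡0 (f + 2 * (a * f)) (trans (sym b*c) (trans (cong (b *_) c≡0) (*-zeroʳ b))))

    -- Now g = f and c = 1 + 2a, so `c*g` reads cf = ac + f². Here a < f, since f ≤ a would give f²
    -- ≤ 0. Substituting f = 1 + a + e turns the equation into a² + e² + e = 0, hence a = e = 0.
    pseudocyclic-values : h ≡ 0 → u ≡ 0 → f ≢ 0 → suc (a + a + g + g) ≡ k → a ≡ 0 × c ≡ 1 × f ≡ 1 × g ≡ 1
    pseudocyclic-values h≡0 u≡0 f≢0 count≡k = a≡0 , trans c≡1+2a (cong (λ a → 1 + a + a) a≡0) , f≡1 , trans g≡f f≡1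
      where
      g≡f : g ≡ f
      g≡f = *-cancelˡ-≡ g f 2 (+-cancelˡ-≡ (a + a) _ _ (begin
        a + a + 2 * g    ≡⟨ ring a g ⟩
        a + a + g + g    ≡⟨ suc-injective (trans count≡k row) ⟩
        a + a + f + f    ≡⟨ ring a f ⟨
        a + a + 2 * f    ∎))
        where
        ring : ∀ a g → a + a + 2 * g ≡ a + a + g + g
        ring = solve-∀
      c≡1+2a : c ≡ 1 + a + a
      c≡1+2a = +-cancelʳ-≡ f _ _ (begin
        c + f            ≡⟨ cong (c +_) g≡f ⟨
        c + g            ≡⟨ trans (+-identityʳ _) (+-identityʳ _) ⟨
        c + g + 0 + 0    ≡⟨ cong₂ (λ h u → c + g + h + u) h≡0 u≡0 ⟨
        c + g + h + u    ≡⟨ c+g+h+u ⟩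
        1 + a + a + f    ∎)
      c*f : c * f ≡ a * c + f * f
      c*f = begin
        c * f                        ≡⟨ cong (c *_) g≡f ⟨
        c * g                        ≡⟨ c*g ⟩
        a * c + f * g + f * h        ≡⟨ cong₂ (λ g h → a * c + f * g + f * h) g≡f h≡0 ⟩
        a * c + f * f + f * 0        ≡⟨ trans (cong (a * c + f * f +_) (*-zeroʳ f)) (+-identityʳ _) ⟩
        a * c + f * f                ∎
      a<f : a < f
      a<f = ≰⇒> λ f≤a → f≢0 (square≡0 (n≤0⇒n≡0 (+-cancelˡ-≤ (a * c) (f * f) 0 (bound f≤a))))
        where
        bound : f ≤ a → a * c + f * f ≤ a * c + 0
        bound f≤a = ≤-trans (≤-reflexive (sym c*f)) (≤-trans (*-monoʳ-≤ c f≤a)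
          (≤-reflexive (trans (*-comm c a) (sym (+-identityʳ (a * c))))))
      e : ℕ
      e = proj₁ (m≤n⇒∃[o]m+o≡n a<f)
      f≡1+a+e : suc a + e ≡ f
      f≡1+a+e = proj₂ (m≤n⇒∃[o]m+o≡n a<f)
      squares : a * a + (e * e + e) ≡ 0
      squares = +-cancelˡ-≡ (c * f) _ _ (begin
        c * f + (a * a + (e * e + e))                                            ≡⟨ cong₂ (λ c f → c * f + (a * a + (e * e + e))) c≡1+2a (sym f≡1+a+e) ⟩
        (1 + a + a) * (1 + a + e) + (a * a + (e * e + e))                        ≡⟨ ring a e ⟩
        a * (1 + a + a) + (1 + a + e) * (1 + a + e)                              ≡⟨ cong₂ (λ c f → a * c + f * f) (sym c≡1+2a) f≡1+a+e ⟩
        a * c + f * f                                                            ≡⟨ c*f ⟨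
        c * f                                                                    ≡⟨ +-identityʳ _ ⟨
        c * f + 0                                                                ∎)
        where
        ring : ∀ a e → (1 + a + a) * (1 + a + e) + (a * a + (e * e + e)) ≡ a * (1 + a + a) + (1 + a + e) * (1 + a + e)
        ring = solve-∀
      a≡0 : a ≡ 0
      a≡0 = square≡0 (m+n≡0⇒m≡0 (a * a) squares)
      f≡1 : f ≡ 1
      f≡1 = trans (sym f≡1+a+e) (cong₂ (λ a e → suc a + e) a≡0 (m+n≡0⇒n≡0 (e * e) (m+n≡0⇒n≡0 (a * a) squares)))

-- Linear algebra over a field without decidable equality

module Linear where
  open import Data.Nat using (ℕ; zero; suc; _<_; s≤s)
  import Data.Nat as ℕ
  import Data.Nat.Properties as ℕ
  open import Data.Bool using (true; if_then_else_)
  open import Data.Fin using (Fin; punchIn)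
  open import Data.Product using (∃-syntax; _×_; _,_)
  open import Function using (_∘_)
  open import Relation.Nullary using (¬_; yes; no; contradiction)
  open import Relation.Nullary.Decidable using (¬¬-excluded-middle)
  import Relation.Binary.PropositionalEquality as ≡
  open ≡ using (_≡_; _≢_)

  -- The double negation monad behind the `do` blocks: inside them excluded middle may be used
  -- freely.
  _>>=_ : ∀ {a b} {P : Set a} {Q : Set b} → ¬ ¬ P → (P → ¬ ¬ Q) → ¬ ¬ Q
  (m >>= f) ¬q = m λ p → f p ¬q

  pure : ∀ {a} {P : Set a} → P → ¬ ¬ P
  pure p ¬p = ¬p p

  -- Finiteness of the index set is what allows the quantifier to move inside.
  ¬¬-Fin : ∀ {ℓ n} {P : Fin n → Set ℓ} → (∀ i → ¬ ¬ P i) → ¬ ¬ (∀ i → P i)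
  ¬¬-Fin {n = zero}  h = pure λ ()
  ¬¬-Fin {n = suc n} h = do
    p₀ ← h F.zero
    ps ← ¬¬-Fin (h ∘ F.suc)
    pure λ { F.zero → p₀ ; (F.suc i) → ps i }

  -- The least number principle for undecidable predicates; it supplies ranks for arbitrary
  -- matrices.
  ¬¬-least : ∀ {ℓ} (P : ℕ → Set ℓ) n → P n → ¬ ¬ (∃[ m ] (P m × ∀ m′ → m′ < m → ¬ P m′))
  ¬¬-least P zero    p = pure (zero , p , λ _ ())
  ¬¬-least P (suc n) p = do
    yes p₀ ← ¬¬-excluded-middle {A = P zero}
      where no ¬p₀ → do
              m , pm , below ← ¬¬-least (P ∘ suc) n p
              pure (suc m , pm , λ { zero _ → ¬p₀ ; (suc m′) (s≤s lt) → below m′ lt })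
    pure (zero , p₀ , λ _ ())

  module LinearAlgebra (K : Char0Field) where
    open Char0Field K
    open Matrices K
    open import Algebra.Properties.Ring ring
      using (-‿distribˡ-*; -‿distribʳ-*; -0#≈0#; -‿+-comm; -‿involutive; +-cancelˡ)
      renaming (x∙y⁻¹≈ε⇒x≈y to x-y≈0⇒x≈y)
    open import Algebra.Properties.CommutativeSemigroup +-commutativeSemigroup
      using (interchange)
    open import Relation.Binary.Reasoning.Setoid setoid

    Σ-cong : ∀ m {f g : Fin m → Carrier} → (∀ i → f i ≈ g i) → Σ[ m ] f ≈ Σ[ m ] g
    Σ-cong zero    f≈g = refl
    Σ-cong (suc m) f≈g = +-cong (f≈g F.zero) (Σ-cong m (f≈g ∘ F.suc))

    Σ-zero : ∀ m {f : Fin m → Carrier} → (∀ i → f i ≈ 0#) → Σ[ m ] f ≈ 0#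
    Σ-zero zero    f≈0 = refl
    Σ-zero (suc m) f≈0 = trans (+-cong (f≈0 F.zero) (Σ-zero m (f≈0 ∘ F.suc))) (+-identityˡ 0#)

    Σ-+ : ∀ m (f g : Fin m → Carrier) → Σ[ m ] (λ i → f i + g i) ≈ Σ[ m ] f + Σ[ m ] g
    Σ-+ zero    f g = sym (+-identityˡ 0#)
    Σ-+ (suc m) f g = trans (+-congˡ (Σ-+ m (f ∘ F.suc) (g ∘ F.suc))) (interchange _ _ _ _)

    Σ-neg : ∀ m (f : Fin m → Carrier) → Σ[ m ] (λ i → - f i) ≈ - Σ[ m ] f
    Σ-neg zero    f = sym -0#≈0#
    Σ-neg (suc m) f = trans (+-congˡ (Σ-neg m (f ∘ F.suc))) (-‿+-comm _ _)

    Σ-*ˡ : ∀ m c (f : Fin m → Carrier) → c * Σ[ m ] f ≈ Σ[ m ] (λ i → c * f i)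
    Σ-*ˡ zero    c f = zeroʳ c
    Σ-*ˡ (suc m) c f = trans (distribˡ c _ _) (+-congˡ (Σ-*ˡ m c (f ∘ F.suc)))

    Σ-*ʳ : ∀ m c (f : Fin m → Carrier) → Σ[ m ] f * c ≈ Σ[ m ] (λ i → f i * c)
    Σ-*ʳ zero    c f = zeroˡ c
    Σ-*ʳ (suc m) c f = trans (distribʳ c _ _) (+-congˡ (Σ-*ʳ m c (f ∘ F.suc)))

    Σ-swap : ∀ m n (f : Fin m → Fin n → Carrier) →
             Σ[ m ] (λ i → Σ[ n ] (f i)) ≈ Σ[ n ] (λ j → Σ[ m ] (λ i → f i j))
    Σ-swap zero    n f = sym (Σ-zero n λ _ → refl)
    Σ-swap (suc m) n f = trans (+-congˡ (Σ-swap m n (f ∘ F.suc))) (sym (Σ-+ n _ _))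

    Σ-punchIn : ∀ m i (f : Fin (suc m) → Carrier) → Σ[ suc m ] f ≈ f i + Σ[ m ] (f ∘ punchIn i)
    Σ-punchIn m       F.zero    f = refl
    Σ-punchIn (suc m) (F.suc i) f = begin
      f F.zero + Σ[ suc m ] (f ∘ F.suc)                                            ≈⟨ +-congˡ (Σ-punchIn m i (f ∘ F.suc)) ⟩
      f F.zero + (f (F.suc i) + Σ[ m ] (f ∘ F.suc ∘ punchIn i))                    ≈⟨ +-assoc _ _ _ ⟨
      f F.zero + f (F.suc i) + Σ[ m ] (f ∘ F.suc ∘ punchIn i)                      ≈⟨ +-congʳ (+-comm _ _) ⟩
      f (F.suc i) + f F.zero + Σ[ m ] (f ∘ F.suc ∘ punchIn i)                      ≈⟨ +-assoc _ _ _ ⟩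
      f (F.suc i) + (f F.zero + Σ[ m ] (f ∘ F.suc ∘ punchIn i))                    ∎

    Σ-δ : ∀ m j (f : Fin m → Carrier) → Σ[ m ] (λ i → f i * (if j =ᶠ i then 1# else 0#)) ≈ f j
    Σ-δ (suc m) F.zero    f = trans (+-cong (*-identityʳ _) (Σ-zero m λ i → zeroʳ (f (F.suc i)))) (+-identityʳ _)
    Σ-δ (suc m) (F.suc j) f = trans (+-cong (zeroʳ _) (Σ-δ m j (f ∘ F.suc))) (+-identityˡ _)

    ι-+ : ∀ m n → ι (m ℕ.+ n) ≈ ι m + ι n
    ι-+ zero    n = sym (+-identityˡ _)
    ι-+ (suc m) n = trans (+-congˡ (ι-+ m n)) (sym (+-assoc _ _ _))

    ι-1 : ι 1 ≈ 1#
    ι-1 = +-identityʳ 1#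

    Σ-const : ∀ m c → Σ[ m ] (λ _ → c) ≈ ι m * c
    Σ-const zero    c = sym (zeroˡ c)
    Σ-const (suc m) c = trans (+-cong (sym (*-identityˡ c)) (Σ-const m c)) (sym (distribʳ c 1# (ι m)))

    ι-* : ∀ m n → ι (m ℕ.* n) ≈ ι m * ι n
    ι-* zero    n = sym (zeroˡ _)
    ι-* (suc m) n = trans (ι-+ n (m ℕ.* n)) (trans (+-cong (sym (*-identityˡ _)) (ι-* m n)) (sym (distribʳ _ _ _)))

    ι-injective : ∀ {m n} → ι m ≈ ι n → m ≡ n
    ι-injective {zero}  {n}     eq = ≡.sym (char0 n (sym eq))
    ι-injective {suc m} {zero}  eq = char0 (suc m) eq
    ι-injective {suc m} {suc n} eq = ≡.cong suc (ι-injective (+-cancelˡ 1# (ι m) (ι n) eq))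

    infixl 6 _⊖_
    _⊖_ : ∀ {a b} → Mat a b → Mat a b → Mat a b
    (M ⊖ N) x y = M x y - N x y

    _ᵀ : ∀ {a b} → Mat a b → Mat b a
    (M ᵀ) x y = M y x

    ⊗-cong : ∀ {a b c} {M M′ : Mat a b} {N N′ : Mat b c} → M ≋ M′ → N ≋ N′ → (M ⊗ N) ≋ (M′ ⊗ N′)
    ⊗-cong {b = b} M≋ N≋ x y = Σ-cong b λ z → *-cong (M≋ x z) (N≋ z y)

    ⊗-assoc : ∀ {a b c d} (L : Mat a b) (M : Mat b c) (N : Mat c d) → ((L ⊗ M) ⊗ N) ≋ (L ⊗ (M ⊗ N))
    ⊗-assoc {a} {b} {c} L M N x y = begin
      Σ[ c ] (λ z → Σ[ b ] (λ w → L x w * M w z) * N z y)      ≈⟨ Σ-cong c (λ z → Σ-*ʳ b _ _) ⟩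
      Σ[ c ] (λ z → Σ[ b ] (λ w → L x w * M w z * N z y))      ≈⟨ Σ-swap c b _ ⟩
      Σ[ b ] (λ w → Σ[ c ] (λ z → L x w * M w z * N z y))      ≈⟨ Σ-cong b (λ w → Σ-cong c λ z → *-assoc _ _ _) ⟩
      Σ[ b ] (λ w → Σ[ c ] (λ z → L x w * (M w z * N z y)))    ≈⟨ Σ-cong b (λ w → Σ-*ˡ c _ _) ⟨
      Σ[ b ] (λ w → L x w * Σ[ c ] (λ z → M w z * N z y))      ∎

    ⊗-distribˡ-⊖ : ∀ {a b c} (L : Mat a b) (M N : Mat b c) → (L ⊗ (M ⊖ N)) ≋ ((L ⊗ M) ⊖ (L ⊗ N))
    ⊗-distribˡ-⊖ {b = b} L M N x y = begin
      Σ[ b ] (λ z → L x z * (M z y - N z y))                            ≈⟨ Σ-cong b (λ z → trans (distribˡ _ _ _) (+-congˡ (sym (-‿distribʳ-* _ _)))) ⟩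
      Σ[ b ] (λ z → L x z * M z y - L x z * N z y)                      ≈⟨ Σ-+ b _ _ ⟩
      (L ⊗ M) x y + Σ[ b ] (λ z → - (L x z * N z y))                    ≈⟨ +-congˡ (Σ-neg b _) ⟩
      (L ⊗ M) x y - (L ⊗ N) x y                                         ∎

    ⊗-distribʳ-⊖ : ∀ {a b c} (M N : Mat a b) (L : Mat b c) → ((M ⊖ N) ⊗ L) ≋ ((M ⊗ L) ⊖ (N ⊗ L))
    ⊗-distribʳ-⊖ {b = b} M N L x y = begin
      Σ[ b ] (λ z → (M x z - N x z) * L z y)                            ≈⟨ Σ-cong b (λ z → trans (distribʳ _ _ _) (+-congˡ (sym (-‿distribˡ-* _ _)))) ⟩
      Σ[ b ] (λ z → M x z * L z y - N x z * L z y)                      ≈⟨ Σ-+ b _ _ ⟩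
      (M ⊗ L) x y + Σ[ b ] (λ z → - (N x z * L z y))                    ≈⟨ +-congˡ (Σ-neg b _) ⟩
      (M ⊗ L) x y - (N ⊗ L) x y                                         ∎

    idM-sym : ∀ {a} (x y : Fin a) → idM x y ≈ idM y x
    idM-sym x y with x F.≟ y | y F.≟ x
    ... | yes _      | yes _  = refl
    ... | no _       | no _   = refl
    ... | yes ≡.refl | no y≢y = contradiction ≡.refl y≢y
    ... | no x≢x | yes ≡.refl = contradiction ≡.refl x≢x

    ⊗-identityʳ : ∀ {a b} (M : Mat a b) → (M ⊗ idM) ≋ M
    ⊗-identityʳ {b = b} M x y = trans (Σ-cong b λ z → *-congˡ (idM-sym z y)) (Σ-δ b y (M x))

    ⊗-identityˡ : ∀ {a b} (M : Mat a b) → (idM ⊗ M) ≋ M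
    ⊗-identityˡ {a} M x y = trans (Σ-cong a λ z → *-comm _ _) (Σ-δ a x (λ z → M z y))

    tr : ∀ {a} → Mat a a → Carrier
    tr {a} M = Σ[ a ] (λ x → M x x)

    tr-cong : ∀ {a} {M N : Mat a a} → M ≋ N → tr M ≈ tr N
    tr-cong {a} M≋N = Σ-cong a λ x → M≋N x x

    tr-comm : ∀ {a b} (M : Mat a b) (N : Mat b a) → tr (M ⊗ N) ≈ tr (N ⊗ M)
    tr-comm {a} {b} M N = trans (Σ-swap a b _) (Σ-cong b λ z → Σ-cong a λ x → *-comm _ _)

    tr-⊖ : ∀ {a} (M N : Mat a a) → tr (M ⊖ N) ≈ tr M - tr N
    tr-⊖ {a} M N = trans (Σ-+ a _ _) (+-congˡ (Σ-neg a _))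

    tr-idM : ∀ a → tr (idM {a}) ≈ ι a
    tr-idM a = trans (Σ-cong a λ x → reflexive (≡.cong (if_then 1# else 0#) (x=x x))) (trans (Σ-const a 1#) (*-identityʳ _))
      where
      x=x : ∀ x → (x =ᶠ x) ≡ true
      x=x x with x F.≟ x
      ... | yes _  = ≡.refl
      ... | no x≢x = contradiction ≡.refl x≢x

    FactorsThrough-ᵀ : ∀ {a b} {M : Mat a b} {r} → FactorsThrough (M ᵀ) r → FactorsThrough M r
    FactorsThrough-ᵀ {r = r} (U , V , M≋) = V ᵀ , U ᵀ , λ x y → trans (M≋ y x) (Σ-cong r λ z → *-comm _ _)

    -- The double negation is what minimality of a factorisation delivers: an entry can be inverted
    -- only after it has been assumed nonzero, and that assumption is then refuted.
    Independent : ∀ {a r} → Mat a r → Set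
    Independent {a} {r} U = ∀ (w : Fin r → Carrier) → (∀ x → Σ[ r ] (λ j → U x j * w j) ≈ 0#) → ∀ j → ¬ ¬ (w j ≈ 0#)

    -- A linear relation between the columns of U expresses one of them by the others.
    drop-column : ∀ {a b r} (U : Mat a (suc r)) (V : Mat (suc r) b) (w : Fin (suc r) → Carrier) →
                  (∀ x → Σ[ suc r ] (λ j → U x j * w j) ≈ 0#) → ∀ i v → w i * v ≈ 1# → FactorsThrough (U ⊗ V) r
    drop-column {a} {b} {r} U V w Uw≈0 i v wv≈1 = U′ , V′ , λ x y → sym (begin
      Σ[ r ] (λ j → U′ x j * V′ j y)                                             ≈⟨ Σ-cong r (λ j → trans (distribˡ _ _ _) (+-congˡ (sym (*-assoc _ _ _)))) ⟩
      Σ[ r ] (λ j → U′ x j * V (punchIn i j) y + U′ x j * c j * V i y)           ≈⟨ Σ-+ r _ _ ⟩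
      rest x y + Σ[ r ] (λ j → U′ x j * c j * V i y)                             ≈⟨ +-congˡ (Σ-*ʳ r _ _) ⟨
      rest x y + Σ[ r ] (λ j → U′ x j * c j) * V i y                             ≈⟨ +-congˡ (*-congʳ (column x)) ⟨
      rest x y + U x i * V i y                                                   ≈⟨ +-comm _ _ ⟩
      U x i * V i y + rest x y                                                   ≈⟨ Σ-punchIn r i (λ j → U x j * V j y) ⟨
      (U ⊗ V) x y                                                                ∎)
      where
      c : Fin r → Carrier
      c j = - (w (punchIn i j) * v)
      U′ : Mat a r
      U′ x j = U x (punchIn i j)
      V′ : Mat r b
      V′ j y = V (punchIn i j) y + c j * V i y
      rest : Mat a b
      rest x y = Σ[ r ] (λ j → U′ x j * V (punchIn i j) y)
      column : ∀ x → U x i ≈ Σ[ r ] (λ j → U′ x j * c j)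
      column x = x-y≈0⇒x≈y _ _ (begin
        U x i - Σ[ r ] (λ j → U′ x j * c j)
          ≈⟨ +-cong (sym (trans (*-assoc _ _ _) (trans (*-congˡ wv≈1) (*-identityʳ _)))) (sym (Σ-neg r _)) ⟩
        U x i * w i * v + Σ[ r ] (λ j → - (U′ x j * c j))
          ≈⟨ +-congˡ (Σ-cong r λ j → trans (-‿distribʳ-* _ _) (trans (*-congˡ (-‿involutive _)) (sym (*-assoc _ _ _)))) ⟩
        U x i * w i * v + Σ[ r ] (λ j → U′ x j * w (punchIn i j) * v)
          ≈⟨ +-congˡ (Σ-*ʳ r v _) ⟨
        U x i * w i * v + Σ[ r ] (λ j → U′ x j * w (punchIn i j)) * v
          ≈⟨ distribʳ v _ _ ⟨
        (U x i * w i + Σ[ r ] (λ j → U′ x j * w (punchIn i j))) * v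
          ≈⟨ *-congʳ (Σ-punchIn r i (λ j → U x j * w j)) ⟨
        Σ[ suc r ] (λ j → U x j * w j) * v
          ≈⟨ *-congʳ (Uw≈0 x) ⟩
        0# * v
          ≈⟨ zeroˡ v ⟩
        0# ∎)

    FactorsThrough-resp : ∀ {a b r} {M N : Mat a b} → M ≋ N → FactorsThrough N r → FactorsThrough M r
    FactorsThrough-resp M≋N (U , V , N≋) = U , V , λ x y → trans (M≋N x y) (N≋ x y)

    minimal⇒independent : ∀ {a b r} {M : Mat a b} (U : Mat a r) (V : Mat r b) → M ≋ (U ⊗ V) →
                          (∀ r′ → r′ < r → ¬ FactorsThrough M r′) → Independent U
    minimal⇒independent {r = suc r} U V M≋ minimal w Uw≈0 j wj≉0 with inverse (w j) wj≉0
    ... | v , wv≈1 = minimal r (ℕ.n<1+n r) (FactorsThrough-resp M≋ (drop-column U V w Uw≈0 j v wv≈1))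

    -- For a minimal factorisation M = UV, idempotency says U(VU - I)V = 0. The columns of U and the
    -- rows of V are independent, so VU = I and tr M = tr UV = tr VU = r.
    idempotent-rank : ∀ {a r} {M : Mat a a} → (M ⊗ M) ≋ M → HasRank M r → ¬ ¬ (tr M ≈ ι r)
    idempotent-rank {a} {r} {M} idem ((U , V , M≋) , minimal) = do
      DV≈0 ← ¬¬-Fin λ j → ¬¬-Fin λ y → U-independent (λ j → (D ⊗ V) j y) (λ x → UDV≈0 x y) j
      D≈0 ← ¬¬-Fin λ j → ¬¬-Fin λ l → V-independent (D j) (λ y → trans (Σ-cong r λ z → *-comm _ _) (DV≈0 j y)) l
      pure (begin
        tr M          ≈⟨ tr-cong M≋ ⟩
        tr (U ⊗ V)    ≈⟨ tr-comm U V ⟩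
        tr (V ⊗ U)    ≈⟨ tr-cong {M = V ⊗ U} {N = idM} (λ j l → x-y≈0⇒x≈y _ _ (D≈0 j l)) ⟩
        tr (idM {r})  ≈⟨ tr-idM r ⟩
        ι r           ∎)
      where
      D : Mat r r
      D = (V ⊗ U) ⊖ idM
      U-independent : Independent U
      U-independent = minimal⇒independent U V M≋ minimal
      V-independent : Independent (V ᵀ)
      V-independent = minimal⇒independent {M = M ᵀ} (V ᵀ) (U ᵀ) (λ x y → trans (M≋ y x) (Σ-cong r λ z → *-comm _ _))
        λ r′ lt → minimal r′ lt ∘ FactorsThrough-ᵀ
      UDV≈0 : ∀ x y → (U ⊗ (D ⊗ V)) x y ≈ 0#
      UDV≈0 x y = begin
        (U ⊗ (D ⊗ V)) x y                                     ≈⟨ ⊗-cong {M = U} (λ _ _ → refl) (⊗-distribʳ-⊖ (V ⊗ U) idM V) x y ⟩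
        (U ⊗ (((V ⊗ U) ⊗ V) ⊖ (idM ⊗ V))) x y                 ≈⟨ ⊗-distribˡ-⊖ U ((V ⊗ U) ⊗ V) (idM ⊗ V) x y ⟩
        (U ⊗ ((V ⊗ U) ⊗ V)) x y - (U ⊗ (idM ⊗ V)) x y         ≈⟨ +-cong (⊗-cong {M = U} (λ _ _ → refl) (⊗-assoc V U V) x y) (-‿cong (⊗-cong {M = U} (λ _ _ → refl) (⊗-identityˡ V) x y)) ⟩
        (U ⊗ (V ⊗ (U ⊗ V))) x y - (U ⊗ V) x y                 ≈⟨ +-congʳ (⊗-assoc U V (U ⊗ V) x y) ⟨
        ((U ⊗ V) ⊗ (U ⊗ V)) x y - (U ⊗ V) x y                 ≈⟨ +-cong (⊗-cong M≋ M≋ x y) (-‿cong (M≋ x y)) ⟨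
        (M ⊗ M) x y - M x y                                   ≈⟨ +-congʳ (idem x y) ⟩
        M x y - M x y                                         ≈⟨ -‿inverseʳ _ ⟩
        0#                                                    ∎

    -- The rank equals the trace, so characteristic 0 makes it the number 0, and a product of inner
    -- width 0 is an empty sum.
    idempotent-trace-zero : ∀ {a} {M : Mat a a} → (M ⊗ M) ≋ M → tr M ≈ 0# → ¬ ¬ (M ≋ zeroM)
    idempotent-trace-zero {a} {M} idem tr≈0 = do
      r , ((U , V , M≋) , minimal) ← ¬¬-least (FactorsThrough M) a (M , idM , λ x y → sym (⊗-identityʳ M x y))
      tr≈r ← idempotent-rank idem ((U , V , M≋) , minimal)
      pure (vanish (char0 r (trans (sym tr≈r) tr≈0)) U V M≋)
      where
      vanish : ∀ {r} → r ≡ 0 → (U : Mat a r) (V : Mat r a) → M ≋ (U ⊗ V) → M ≋ zeroM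
      vanish ≡.refl U V M≋ = M≋

    -- I - XC is idempotent because CX = I, and its trace is tr I - tr CX = 0.
    right-inverse⇒left-inverse : ∀ {a} (C X : Mat a a) → (C ⊗ X) ≋ idM → ¬ ¬ ((X ⊗ C) ≋ idM)
    right-inverse⇒left-inverse {a} C X CX≋I = do
      Q≋0 ← idempotent-trace-zero {M = Q} Q-idem trQ≈0
      pure λ x y → sym (x-y≈0⇒x≈y _ _ (Q≋0 x y))
      where
      P Q : Mat a a
      P = X ⊗ C
      Q = idM ⊖ P
      P-idem : (P ⊗ P) ≋ P
      P-idem x y = begin
        ((X ⊗ C) ⊗ (X ⊗ C)) x y     ≈⟨ ⊗-assoc X C (X ⊗ C) x y ⟩
        (X ⊗ (C ⊗ (X ⊗ C))) x y     ≈⟨ ⊗-cong {M = X} (λ _ _ → refl) (⊗-assoc C X C) x y ⟨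
        (X ⊗ ((C ⊗ X) ⊗ C)) x y     ≈⟨ ⊗-cong {M = X} (λ _ _ → refl) (⊗-cong {N = C} CX≋I (λ _ _ → refl)) x y ⟩
        (X ⊗ (idM ⊗ C)) x y         ≈⟨ ⊗-cong {M = X} (λ _ _ → refl) (⊗-identityˡ C) x y ⟩
        (X ⊗ C) x y                 ∎
      PQ≈0 : ∀ x y → (P ⊗ Q) x y ≈ 0#
      PQ≈0 x y = begin
        (P ⊗ Q) x y                     ≈⟨ ⊗-distribˡ-⊖ P idM P x y ⟩
        (P ⊗ idM) x y - (P ⊗ P) x y     ≈⟨ +-cong (⊗-identityʳ P x y) (-‿cong (P-idem x y)) ⟩
        P x y - P x y                   ≈⟨ -‿inverseʳ _ ⟩
        0#                              ∎
      Q-idem : (Q ⊗ Q) ≋ Q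
      Q-idem x y = begin
        (Q ⊗ Q) x y                     ≈⟨ ⊗-distribʳ-⊖ idM P Q x y ⟩
        (idM ⊗ Q) x y - (P ⊗ Q) x y     ≈⟨ +-cong (⊗-identityˡ Q x y) (-‿cong (PQ≈0 x y)) ⟩
        Q x y - 0#                      ≈⟨ trans (+-congˡ -0#≈0#) (+-identityʳ _) ⟩
        Q x y                           ∎
      trQ≈0 : tr Q ≈ 0#
      trQ≈0 = begin
        tr Q                            ≈⟨ tr-⊖ idM P ⟩
        tr (idM {a}) - tr (X ⊗ C)       ≈⟨ +-congˡ (-‿cong (trans (tr-comm X C) (tr-cong CX≋I))) ⟩
        tr (idM {a}) - tr (idM {a})     ≈⟨ -‿inverseʳ _ ⟩
        0#                              ∎

-- Multiplicities and the Casimir element of the Bose-Mesner algebra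

module Traces where
  open FiniteSums
  open SchemeTheory
  open Linear
  open import Data.Nat using (ℕ; zero; suc; ≢-nonZero)
  import Data.Nat as ℕ
  import Data.Nat.Properties as ℕ
  open import Data.Bool using (true; false; if_then_else_)
  open import Data.Product using (_,_; proj₁; proj₂)
  open import Function using (_∘_)
  open import Relation.Nullary using (¬_; yes; no; Dec)
  open import Relation.Nullary.Decidable using (decidable-stable)
  import Relation.Binary.PropositionalEquality as ≡
  open ≡ using (_≡_; _≢_)

  module BoseMesnerTraces {n d : ℕ} (S : Scheme n d) (K : Char0Field) where
    open Char0Field K
    open Matrices K
    open BoseMesner S
    open LinearAlgebra K
    open Scheme S
    open SchemeProperties S
    open import Algebra.Properties.CommutativeSemigroup *-commutativeSemigroup
      using (x∙yz≈y∙xz)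
    open import Relation.Binary.Reasoning.Setoid setoid

    ι-sum : ∀ {m} (f : Fin m → ℕ) → ι (sum f) ≈ Σ[ m ] (ι ∘ f)
    ι-sum {zero}  f = refl
    ι-sum {suc m} f = trans (ι-+ (f F.zero) (sum (f ∘ F.suc))) (+-congˡ (ι-sum (f ∘ F.suc)))

    ι-𝟙 : ∀ b → ι (𝟙 b) ≈ (if b then 1# else 0#)
    ι-𝟙 true  = ι-1
    ι-𝟙 false = refl

    Σ-rel : ∀ x (φ : Fin (suc d) → Carrier) → Σ[ n ] (λ z → φ (rel x z)) ≈ Σ[ suc d ] (λ j → φ j * ι (k j))
    Σ-rel x φ = begin
      Σ[ n ] (λ z → φ (rel x z))                            ≈⟨ Σ-cong n (λ z → Σ-δ (suc d) (rel x z) φ) ⟨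
      Σ[ n ] (λ z → Σ[ suc d ] (λ j → φ j * A j x z))       ≈⟨ Σ-swap n (suc d) (λ z j → φ j * A j x z) ⟩
      Σ[ suc d ] (λ j → Σ[ n ] (λ z → φ j * A j x z))       ≈⟨ Σ-cong (suc d) (λ j → Σ-*ˡ n (φ j) (A j x)) ⟨
      Σ[ suc d ] (λ j → φ j * Σ[ n ] (A j x))               ≈⟨ Σ-cong (suc d) (λ j → *-congˡ {φ j} (degree j)) ⟩
      Σ[ suc d ] (λ j → φ j * ι (k j))                      ∎
      where
      degree : ∀ j → Σ[ n ] (A j x) ≈ ι (k j)
      degree j = begin
        Σ[ n ] (A j x)                ≈⟨ Σ-cong n (λ z → ι-𝟙 (rel x z =ᶠ j)) ⟨
        Σ[ n ] (λ z → ι (R j x z))    ≈⟨ ι-sum (R j x) ⟨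
        ι (sum (R j x))               ≡⟨ ≡.cong ι (valency j x) ⟩
        ι (k j)                       ∎

    module _ {E : Fin (suc d) → Mat n n} (idempotents : PrimitiveIdempotents E) where
      open PrimitiveIdempotents idempotents

      -- `C i j` is the coefficient of A_j in E_i: up to the factor 1/n, the dual eigenvalues of the
      -- scheme.
      C : Mat (suc d) (suc d)
      C i = proj₁ (inBM i)

      E≈C : ∀ i x y → E i x y ≈ C i (rel x y)
      E≈C i x y = trans (proj₂ (inBM i) x y) (Σ-δ (suc d) (rel x y) (C i))

      tr-E₀ : tr (E F.zero) ≈ 1#
      tr-E₀ = begin
        Σ[ n ] (λ x → E F.zero x x)         ≈⟨ Σ-cong n (λ x → trans (E≈C F.zero x x) (reflexive (≡.cong (C F.zero) (rel0' x)))) ⟩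
        Σ[ n ] (λ x → C F.zero F.zero)      ≈⟨ Σ-const n _ ⟩
        ι n * C F.zero F.zero               ≈⟨ *-congˡ (trans (E≈C F.zero x₀ x₀) (reflexive (≡.cong (C F.zero) (rel0' x₀)))) ⟨
        ι n * E F.zero x₀ x₀                ≈⟨ E0 x₀ x₀ ⟩
        1#                                  ∎
        where
        x₀ = proj₁ (nonempty F.zero)

      -- The trace form in coordinates: it pairs A_j only with A_j*, with weight n k_j.
      tr-⊗ : ∀ i i′ → tr (E i ⊗ E i′) ≈ ι n * Σ[ suc d ] (λ j → C i j * C i′ (star j) * ι (k j))
      tr-⊗ i i′ = begin
        Σ[ n ] (λ x → Σ[ n ] (λ z → E i x z * E i′ z x))
          ≈⟨ Σ-cong n (λ x → Σ-cong n λ z → *-cong (E≈C i x z) (trans (E≈C i′ z x) (reflexive (≡.cong (C i′) (transpose x z))))) ⟩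
        Σ[ n ] (λ x → Σ[ n ] (λ z → C i (rel x z) * C i′ (star (rel x z))))
          ≈⟨ Σ-cong n (λ x → Σ-rel x (λ j → C i j * C i′ (star j))) ⟩
        Σ[ n ] (λ x → Σ[ suc d ] (λ j → C i j * C i′ (star j) * ι (k j)))
          ≈⟨ Σ-const n _ ⟩
        ι n * Σ[ suc d ] (λ j → C i j * C i′ (star j) * ι (k j)) ∎

      -- E₀/m₀ + … + E_d/m_d is the Casimir element ∑ A_j A_j*/(n k_j) of the algebra,
      -- because both A_j*/(n k_j) and E_i/m_i are dual bases for the trace form.
      casimir : (s : Fin (suc d) → Carrier) → (∀ i → tr (E i) * s i ≈ 1#) →
        ¬ ¬ (∀ x y z → ι (k (rel z x)) * (ι n * Σ[ suc d ] (λ i → s i * (E i x z * E i z y))) ≈ idM (rel z x) (rel z y))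
      casimir s trE*s≈1 = do
        -- `CX≋I` is the orthogonality of the E_i for the trace form. Multiplying in the other order
        -- gives the orthogonality indexed by relations, which is the claim.
        XC≋I ← right-inverse⇒left-inverse C X CX≋I
        pure λ x y z → trans (sym (begin
          Σ[ suc d ] (λ i → ι n * (ι (k (rel z x)) * (C i (star (rel z x)) * s i)) * C i (rel z y))
            ≈⟨ Σ-cong (suc d) (λ i → rearrange (ι n) (ι (k (rel z x))) (C i (star (rel z x))) (s i) (C i (rel z y))) ⟩
          Σ[ suc d ] (λ i → ι (k (rel z x)) * (ι n * (s i * (C i (star (rel z x)) * C i (rel z y)))))
            ≈⟨ trans (*-congˡ (Σ-*ˡ (suc d) (ι n) (λ i → s i * (C i (star (rel z x)) * C i (rel z y)))))
                 (Σ-*ˡ (suc d) (ι (k (rel z x))) (λ i → ι n * (s i * (C i (star (rel z x)) * C i (rel z y))))) ⟨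
          ι (k (rel z x)) * (ι n * Σ[ suc d ] (λ i → s i * (C i (star (rel z x)) * C i (rel z y))))
            ≈⟨ *-congˡ (*-congˡ (Σ-cong (suc d) λ i → *-congˡ {s i} (*-cong (trans (E≈C i x z) (reflexive (≡.cong (C i) (transpose z x)))) (E≈C i z y)))) ⟨
          ι (k (rel z x)) * (ι n * Σ[ suc d ] (λ i → s i * (E i x z * E i z y))) ∎))
          (XC≋I (rel z x) (rel z y))
        where
        X : Mat (suc d) (suc d)
        X j i = ι n * (ι (k j) * (C i (star j) * s i))
        rearrange : ∀ n k c s c′ → n * (k * (c * s)) * c′ ≈ k * (n * (s * (c * c′)))
        rearrange n k c s c′ = begin
          n * (k * (c * s)) * c′      ≈⟨ *-congʳ (x∙yz≈y∙xz n k (c * s)) ⟩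
          k * (n * (c * s)) * c′      ≈⟨ *-assoc k _ c′ ⟩
          k * (n * (c * s) * c′)      ≈⟨ *-congˡ (*-assoc n _ c′) ⟩
          k * (n * (c * s * c′))      ≈⟨ *-congˡ (*-congˡ (trans (*-congʳ (*-comm c s)) (*-assoc s c c′))) ⟩
          k * (n * (s * (c * c′)))    ∎
        tr-⊗-δ : ∀ i i′ → tr (E i ⊗ E i′) * s i′ ≈ idM i i′
        tr-⊗-δ i i′ with i F.≟ i′
        ... | yes ≡.refl = trans (*-congʳ (tr-cong (idem i))) (trE*s≈1 i)
        ... | no  i≢i′   = trans (*-congʳ (trans (tr-cong {N = zeroM} (orth i i′ i≢i′)) (Σ-zero n λ _ → refl))) (zeroˡ _)
        CX≋I : (C ⊗ X) ≋ idM
        CX≋I i i′ = begin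
          Σ[ suc d ] (λ j → C i j * (ι n * (ι (k j) * (C i′ (star j) * s i′))))
            ≈⟨ Σ-cong (suc d) (λ j → rearrange′ (C i j) (ι n) (ι (k j)) (C i′ (star j)) (s i′)) ⟩
          Σ[ suc d ] (λ j → ι n * (C i j * C i′ (star j) * ι (k j)) * s i′)
            ≈⟨ trans (*-congʳ (Σ-*ˡ (suc d) (ι n) (λ j → C i j * C i′ (star j) * ι (k j)))) (Σ-*ʳ (suc d) (s i′) (λ j → ι n * (C i j * C i′ (star j) * ι (k j)))) ⟨
          ι n * Σ[ suc d ] (λ j → C i j * C i′ (star j) * ι (k j)) * s i′
            ≈⟨ *-congʳ (tr-⊗ i i′) ⟨
          tr (E i ⊗ E i′) * s i′
            ≈⟨ tr-⊗-δ i i′ ⟩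
          idM i i′ ∎
          where
          rearrange′ : ∀ c n k c′ s → c * (n * (k * (c′ * s))) ≈ n * (c * c′ * k) * s
          rearrange′ c n k c′ s = begin
            c * (n * (k * (c′ * s)))    ≈⟨ x∙yz≈y∙xz c n _ ⟩
            n * (c * (k * (c′ * s)))    ≈⟨ *-congˡ (*-congˡ (trans (sym (*-assoc k c′ s)) (*-congʳ (*-comm k c′)))) ⟩
            n * (c * (c′ * k * s))      ≈⟨ *-congˡ (trans (sym (*-assoc c _ s)) (*-congʳ (sym (*-assoc c c′ k)))) ⟩
            n * (c * c′ * k * s)        ≈⟨ *-assoc n _ s ⟨
            n * (c * c′ * k) * s        ∎

      module _ {m κ : ℕ} (ranks : ∀ i → i ≢ F.zero → HasRank (E i) m)
               (valencies : ∀ i → i ≢ F.zero → k i ≡ κ) {x y} (x≁y : rel x y ≢ F.zero) where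

        private
          N : ℕ
          N = sum (λ z → 𝟙 (rel z x =ᶠ rel z y))

          κ≢0 : κ ≢ 0
          κ≢0 κ≡0 = valency-pos (rel x y) (≡.trans (valencies _ x≁y) κ≡0)

          d≢0 : ∀ {d} {i : Fin (suc d)} → i ≢ F.zero → d ≢ 0
          d≢0 {i = F.zero}  i≢0 ≡.refl = i≢0 ≡.refl

          -- The trace of I is 1 + dm as the sum of the traces of the E_i, and 1 + dκ as the number
          -- of points sorted by their relation to `x`.
          m≡κ : (∀ i → tr (E (F.suc i)) ≈ ι m) → m ≡ κ
          m≡κ traces = ℕ.*-cancelˡ-≡ m κ d {{≢-nonZero (d≢0 x≁y)}} (ℕ.suc-injective (ι-injective (begin
            1# + ι (d ℕ.* m)                                     ≈⟨ +-cong tr-E₀ (trans (Σ-cong d traces) (trans (Σ-const d (ι m)) (sym (ι-* d m)))) ⟨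
            tr (E F.zero) + Σ[ d ] (λ i → tr (E (F.suc i)))      ≈⟨ Σ-swap (suc d) n (λ i z → E i z z) ⟩
            tr (λ x y → Σ[ suc d ] (λ i → E i x y))              ≈⟨ tr-cong sumId ⟩
            tr (idM {n})                                         ≈⟨ tr-idM n ⟩
            ι n                                                  ≈⟨ trans (Σ-const n 1#) (*-identityʳ _) ⟨
            Σ[ n ] (λ _ → 1#)                                    ≈⟨ Σ-rel x (λ _ → 1#) ⟩
            Σ[ suc d ] (λ j → 1# * ι (k j))                      ≈⟨ Σ-cong (suc d) (λ j → *-identityˡ (ι (k j))) ⟩
            ι (k F.zero) + Σ[ d ] (λ j → ι (k (F.suc j)))        ≈⟨ +-cong (trans (reflexive (≡.cong ι k-zero)) ι-1) (Σ-cong d λ j → reflexive (≡.cong ι (valencies (F.suc j) λ ()))) ⟩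
            1# + Σ[ d ] (λ _ → ι κ)                              ≈⟨ +-congˡ (trans (Σ-const d (ι κ)) (sym (ι-* d κ))) ⟩
            1# + ι (d ℕ.* κ)                                     ∎)))

          module _ (traces : ∀ i → tr (E (F.suc i)) ≈ ι m) {v} (κv≈1 : ι κ * v ≈ 1#) where

            s : Fin (suc d) → Carrier
            s F.zero    = 1#
            s (F.suc _) = v

            trE*s≈1 : ∀ i → tr (E i) * s i ≈ 1#
            trE*s≈1 F.zero    = trans (*-identityʳ _) tr-E₀
            trE*s≈1 (F.suc i) = trans (*-congʳ (trans (traces i) (reflexive (≡.cong ι (m≡κ traces))))) κv≈1

            W : Carrier
            W = Σ[ suc d ] (λ i → s i * E i x y)

            -- Replacing each E_i by its square turns `W` into a sum over `z` of Casimir entries,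
            -- and κn times such an entry is 1 or 0 according to whether (z,x) and (z,y) lie in a
            -- common relation.
            count-W : ¬ ¬ (ι κ * (ι n * W) ≈ ι N)
            count-W = do
              cas ← casimir s trE*s≈1
              pure (begin
                ι κ * (ι n * W)                     ≈⟨ *-congˡ (*-congˡ W≈) ⟩
                ι κ * (ι n * Σ[ n ] w)              ≈⟨ trans (*-congˡ (Σ-*ˡ n (ι n) w)) (Σ-*ˡ n (ι κ) _) ⟩
                Σ[ n ] (λ z → ι κ * (ι n * w z))    ≈⟨ Σ-cong n (λ z → term z (cas x y z)) ⟩
                Σ[ n ] (λ z → ι (𝟙 (rel z x =ᶠ rel z y))) ≈⟨ ι-sum (λ z → 𝟙 (rel z x =ᶠ rel z y)) ⟨
                ι N                                 ∎)
              where
              w : Fin n → Carrier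
              w z = Σ[ suc d ] (λ i → s i * (E i x z * E i z y))
              W≈ : W ≈ Σ[ n ] w
              W≈ = begin
                Σ[ suc d ] (λ i → s i * E i x y)                                 ≈⟨ Σ-cong (suc d) (λ i → *-congˡ {s i} (idem i x y)) ⟨
                Σ[ suc d ] (λ i → s i * Σ[ n ] (λ z → E i x z * E i z y))        ≈⟨ Σ-cong (suc d) (λ i → Σ-*ˡ n (s i) (λ z → E i x z * E i z y)) ⟩
                Σ[ suc d ] (λ i → Σ[ n ] (λ z → s i * (E i x z * E i z y)))      ≈⟨ Σ-swap (suc d) n (λ i z → s i * (E i x z * E i z y)) ⟩
                Σ[ n ] w                                                         ∎
              term : ∀ z → ι (k (rel z x)) * (ι n * w z) ≈ idM (rel z x) (rel z y) →
                     ι κ * (ι n * w z) ≈ ι (𝟙 (rel z x =ᶠ rel z y))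
              term z eq = byCases (rel z x F.≟ F.zero)
                where
                byCases : Dec (rel z x ≡ F.zero) → ι κ * (ι n * w z) ≈ ι (𝟙 (rel z x =ᶠ rel z y))
                byCases (no ≢0) = trans (*-congʳ (reflexive (≡.cong ι (≡.sym (valencies _ ≢0))))) (trans eq (sym (ι-𝟙 _)))
                -- At z = x the valency in the Casimir identity is 1 and not κ. This does no harm,
                -- because both sides vanish there.
                byCases (yes ≡0) = begin
                  ι κ * (ι n * w z)                  ≈⟨ *-congˡ nw≈0 ⟩
                  ι κ * 0#                           ≈⟨ zeroʳ _ ⟩
                  0#                                 ≡⟨ ≡.cong (λ b → ι (𝟙 b)) distinct ⟨
                  ι (𝟙 (rel z x =ᶠ rel z y))         ∎
                  where
                  distinct : (rel z x =ᶠ rel z y) ≡ false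
                  distinct = =ᶠ-≢ λ eq′ → x≁y (≡.subst (λ x → rel x y ≡ F.zero) (rel0 z x ≡0) (≡.trans (≡.sym eq′) ≡0))
                  nw≈0 : ι n * w z ≈ 0#
                  nw≈0 = begin
                    ι n * w z                        ≈⟨ *-identityˡ _ ⟨
                    1# * (ι n * w z)                 ≈⟨ *-congʳ ι-1 ⟨
                    ι 1 * (ι n * w z)                ≡⟨ ≡.cong (λ t → ι t * (ι n * w z)) (≡.trans (≡.cong k ≡0) k-zero) ⟨
                    ι (k (rel z x)) * (ι n * w z)    ≈⟨ eq ⟩
                    idM (rel z x) (rel z y)          ≡⟨ ≡.cong (if_then 1# else 0#) distinct ⟩
                    0#                               ∎

            -- Off the diagonal the E_i sum to 0, so those with i ≥ 1 sum to -e, where e = 1/n is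
            -- the entry of E₀. Thus W = e - ve with v = 1/κ.
            W-value : 1# + ι κ * (ι n * W) ≈ ι κ
            W-value = begin
              1# + ι κ * (ι n * W)                             ≈⟨ +-congʳ κv≈1 ⟨
              ι κ * v + ι κ * (ι n * W)                        ≈⟨ distribˡ (ι κ) _ _ ⟨
              ι κ * (v + ι n * W)                              ≈⟨ *-congˡ (+-congʳ (trans (sym (*-identityʳ v)) (trans (*-congˡ (sym (E0 x y))) (x∙yz≈y∙xz v (ι n) e)))) ⟩
              ι κ * (ι n * (v * e) + ι n * W)                  ≈⟨ *-congˡ (distribˡ (ι n) _ _) ⟨
              ι κ * (ι n * (v * e + W))                        ≈⟨ *-congˡ (*-congˡ ve+W≈e) ⟩
              ι κ * (ι n * e)                                  ≈⟨ *-congˡ (E0 x y) ⟩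
              ι κ * 1#                                         ≈⟨ *-identityʳ _ ⟩
              ι κ                                              ∎
              where
              e rest : Carrier
              e = E F.zero x y
              rest = Σ[ d ] (λ i → E (F.suc i) x y)
              e+rest≈0 : e + rest ≈ 0#
              e+rest≈0 = trans (sumId x y) (reflexive (≡.cong (if_then 1# else 0#) (=ᶠ-≢ λ x≡y → x≁y (≡.trans (≡.cong (rel x) (≡.sym x≡y)) (rel0' x)))))
              ve+W≈e : v * e + W ≈ e
              ve+W≈e = begin
                v * e + (1# * e + Σ[ d ] (λ i → v * E (F.suc i) x y))    ≈⟨ +-congˡ (+-cong (*-identityˡ e) (sym (Σ-*ˡ d v _))) ⟩
                v * e + (e + v * rest)                                   ≈⟨ +-congˡ (+-comm e _) ⟩
                v * e + (v * rest + e)                                   ≈⟨ +-assoc _ _ _ ⟨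
                v * e + v * rest + e                                     ≈⟨ +-congʳ (distribˡ v e rest) ⟨
                v * (e + rest) + e                                       ≈⟨ +-congʳ (trans (*-congˡ e+rest≈0) (zeroʳ v)) ⟩
                0# + e                                                   ≈⟨ +-identityˡ e ⟩
                e                                                        ∎

        pseudocyclic-count : suc N ≡ κ
        pseudocyclic-count = decidable-stable (suc N ℕ.≟ κ) do
          traces ← ¬¬-Fin (λ i → idempotent-rank (idem (F.suc i)) (ranks (F.suc i) λ ()))
          let v , κv≈1 = inverse (ι κ) (κ≢0 ∘ char0 κ)
          W≈N ← count-W traces κv≈1
          pure (ι-injective (trans (+-congˡ (sym W≈N)) (W-value traces κv≈1)))

-- The scheme Cyc(13,4) and its reconstruction by constraint propagation

module Cyclotomic where
  open import Data.Nat using (ℕ; suc)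
  import Data.Nat as ℕ
  import Data.Nat.Properties as ℕ
  open import Data.Nat.DivMod using (_mod_; _%_; %-distribˡ-*; m%n%n≡m%n; m%n<n)
  open import Data.Fin.Patterns
  open import Data.Fin.Properties using (all?; any?; toℕ-fromℕ<; <⇒notInjective; punchOut-injective)
  open import Data.List using (List; []; _∷_; _++_; filter; allFin; map; concatMap)
  open import Level using (0ℓ)
  open import Relation.Unary using (Pred; Decidable)
  open import Data.List.Membership.Propositional using (_∈_; lose)
  open import Data.List.Membership.Propositional.Properties using (∈-filter⁺; ∈-allFin)
  open import Data.List.Relation.Unary.All as All using (All; []; _∷_)
  open import Data.List.Relation.Unary.Any as Any using (Any)
  import Data.Vec as V
  open V using (Vec; []; _∷_; lookup; tabulate)
  open import Data.Vec.Properties using (lookup∘tabulate)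
  open import Data.List.Relation.Unary.All.Properties using (++⁺; map⁺)
  open import Data.Product using (∃-syntax; _×_; _,_)
  open import Data.Product.Properties using (≡-dec)
  open import Data.Sum using (_⊎_)
  open import Data.Unit using (tt)
  open import Function.Definitions using (Injective)
  open import Function.Bundles using (_⇔_; mk⇔)
  open import Relation.Nullary using (¬_; yes; no; contradiction; Dec)
  open import Relation.Nullary.Decidable using (toWitness; from-yes; _→-dec_; _×-dec_; _⊎-dec_; ¬?)
  open import Relation.Binary.PropositionalEquality

  -- The class of a residue r modulo 13: i when r ∈ 2ⁱ⟨2⁴⟩ with 1 ≤ i ≤ 4, and 0 when r = 0.
  class : ℕ → Fin 5
  class r = lookup (0F ∷ 4F ∷ 1F ∷ 4F ∷ 2F ∷ 1F ∷ 1F ∷ 3F ∷ 3F ∷ 4F ∷ 2F ∷ 3F ∷ 2F ∷ []) (r mod 13)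

  difference : Fin 13 → Fin 13 → ℕ
  difference x y = (toℕ x ℕ.+ (13 ℕ.∸ toℕ y)) % 13

  cyc : Fin 13 → Fin 13 → Fin 5
  cyc x y = class (difference x y)

  -- As 2¹² = 4096 is 1 modulo 13, the residue has period 3 in `t`, and three values remain to be
  -- computed.
  class-power : ∀ (i : Fin 4) t → class (2 ℕ.^ (suc (toℕ i) ℕ.+ 4 ℕ.* t) % 13) ≡ F.suc i
  class-power i 0 = from-yes (all? λ (i : Fin 4) → class (2 ℕ.^ (suc (toℕ i) ℕ.+ 4 ℕ.* 0) % 13) F.≟ F.suc i) i
  class-power i 1 = from-yes (all? λ (i : Fin 4) → class (2 ℕ.^ (suc (toℕ i) ℕ.+ 4 ℕ.* 1) % 13) F.≟ F.suc i) i
  class-power i 2 = from-yes (all? λ (i : Fin 4) → class (2 ℕ.^ (suc (toℕ i) ℕ.+ 4 ℕ.* 2) % 13) F.≟ F.suc i) i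
  class-power i (suc (suc (suc t))) = trans (cong class period) (class-power i t)
    where
    open ≡-Reasoning
    e = suc (toℕ i)
    period : 2 ℕ.^ (e ℕ.+ 4 ℕ.* (3 ℕ.+ t)) % 13 ≡ 2 ℕ.^ (e ℕ.+ 4 ℕ.* t) % 13
    period = begin
      2 ℕ.^ (e ℕ.+ 4 ℕ.* (3 ℕ.+ t)) % 13               ≡⟨ cong (λ k → 2 ℕ.^ k % 13) shift ⟩
      2 ℕ.^ (e ℕ.+ 4 ℕ.* t ℕ.+ 12) % 13                ≡⟨ cong (_% 13) (ℕ.^-distribˡ-+-* 2 (e ℕ.+ 4 ℕ.* t) 12) ⟩
      2 ℕ.^ (e ℕ.+ 4 ℕ.* t) ℕ.* 4096 % 13              ≡⟨ %-distribˡ-* (2 ℕ.^ (e ℕ.+ 4 ℕ.* t)) 4096 13 ⟩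
      2 ℕ.^ (e ℕ.+ 4 ℕ.* t) % 13 ℕ.* 1 % 13            ≡⟨ cong (_% 13) (ℕ.*-identityʳ (2 ℕ.^ (e ℕ.+ 4 ℕ.* t) % 13)) ⟩
      2 ℕ.^ (e ℕ.+ 4 ℕ.* t) % 13 % 13                  ≡⟨ m%n%n≡m%n (2 ℕ.^ (e ℕ.+ 4 ℕ.* t)) 13 ⟩
      2 ℕ.^ (e ℕ.+ 4 ℕ.* t) % 13                       ∎
      where
      shift : e ℕ.+ 4 ℕ.* (3 ℕ.+ t) ≡ e ℕ.+ 4 ℕ.* t ℕ.+ 12
      shift = trans (cong (e ℕ.+_) (trans (ℕ.*-distribˡ-+ 4 3 t) (ℕ.+-comm 12 (4 ℕ.* t)))) (sym (ℕ.+-assoc e (4 ℕ.* t) 12))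

  cyc-zero : ∀ x y → cyc x y ≡ 0F → x ≡ y
  cyc-zero = from-yes (all? λ x → all? λ y → (cyc x y F.≟ 0F) →-dec (x F.≟ y))

  -- The exponent is searched in `Fin 3` because ⟨2⁴⟩ has order 3; the bound makes the statement
  -- decidable.
  class⇒power : ∀ (r : Fin 13) (i : Fin 4) → class (toℕ r) ≡ F.suc i → ∃[ t ] toℕ r ≡ 2 ℕ.^ (suc (toℕ i) ℕ.+ 4 ℕ.* toℕ {3} t) % 13
  class⇒power = toWitness {a? = all? λ r → all? λ i → (class (toℕ r) F.≟ F.suc i) →-dec
    any? λ t → toℕ r ℕ.≟ 2 ℕ.^ (suc (toℕ i) ℕ.+ 4 ℕ.* toℕ {3} t) % 13} tt

  cyc-power : ∀ x y (i : Fin 4) → cyc x y ≡ F.suc i → ∃[ t ] difference x y ≡ 2 ℕ.^ (suc (toℕ i) ℕ.+ 4 ℕ.* t) % 13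
  cyc-power x y i eq = let t , r≡ = class⇒power r i (trans (cong class toℕ-r) eq) in toℕ t , trans (sym toℕ-r) r≡
    where
    r : Fin 13
    r = F.fromℕ< (m%n<n (toℕ x ℕ.+ (13 ℕ.∸ toℕ y)) 13)
    toℕ-r : toℕ r ≡ difference x y
    toℕ-r = toℕ-fromℕ< (m%n<n (toℕ x ℕ.+ (13 ℕ.∸ toℕ y)) 13)

  cyc⇔CycRel : ∀ x y i → cyc x y ≡ i ⇔ CycRel i x y
  cyc⇔CycRel x y 0F        = mk⇔ (cyc-zero x y) λ { refl → from-yes (all? λ x → cyc x x F.≟ 0F) x }
  cyc⇔CycRel x y (F.suc i) = mk⇔ (cyc-power x y i)
    λ { (t , eq) → trans (cong class eq) (class-power i t) }

  injective⇒strictlySurjective : ∀ {m n} {f : Fin m → Fin n} → m ≡ n → Injective _≡_ _≡_ f → ∀ y → ∃[ x ] f x ≡ y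
  injective⇒strictlySurjective {suc n} {f = f} refl inj y with any? (λ x → f x F.≟ y)
  ... | yes hit  = hit
  ... | no ¬hit = contradiction (λ {i} {j} eq → inj (punchOut-injective (avoid i) (avoid j) eq)) (<⇒notInjective (ℕ.n<1+n n))
    where
    avoid : ∀ x → y ≢ f x
    avoid x y≡fx = ¬hit (x , sym y≡fx)

  -- Modulo 13, -1 = 2⁶, so transposing shifts the four nonzero classes cyclically by 2.
  star₅ : Fin 5 → Fin 5
  star₅ = lookup (0F ∷ 3F ∷ 4F ∷ 1F ∷ 2F ∷ [])

  Triple : Set
  Triple = Fin 5 × Fin 5 × Fin 5

  -- (l , i , j) stands for the intersection number pˡᵢⱼ; its vanishing is invariant under these.
  flip-ij mirror rotate : Triple → Triple
  flip-ij (l , i , j) = l , j , i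
  mirror  (l , i , j) = star₅ l , star₅ i , star₅ j
  rotate  (l , i , j) = i , l , star₅ j

  -- `flip-ij` and `rotate` are involutions whose product has cube `mirror`. They generate a group
  -- of order 12, and `rotations` lists one representative of each coset of `mirror`.
  rotations orbit : Triple → List Triple
  rotations t = t ∷ flip-ij t ∷ rotate t ∷ rotate (flip-ij t) ∷ flip-ij (rotate t) ∷ rotate (flip-ij (rotate t)) ∷ []
  orbit t = rotations t ++ rotations (mirror t)

  -- Writing 3 and 4 for 1* and 2*, these express a = 0, the absence of R₂* from R₁², h = 0 in the
  -- shifted form p¹₂₂ = 0, and p²₂₂ = 0.
  triangles₀ : List Triple
  triangles₀ = (1F , 1F , 1F) ∷ (4F , 1F , 1F) ∷ (1F , 2F , 2F) ∷ (2F , 2F , 2F) ∷ []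

  Forbidden₀ : Pred Triple 0ℓ
  Forbidden₀ (l , i , j) = (j ≡ 0F × l ≢ i) ⊎ (l , i , j) ∈ triangles₀

  forbidden₀? : Decidable Forbidden₀
  forbidden₀? (l , i , j) = ((j F.≟ 0F) ×-dec ¬? (l F.≟ i)) ⊎-dec Any.any? (≡-dec F._≟_ (≡-dec F._≟_ F._≟_) (l , i , j)) triangles₀

  Forbidden : Pred Triple 0ℓ
  Forbidden t = Any Forbidden₀ (orbit t)

  forbidden? : Decidable Forbidden
  forbidden? t = Any.any? forbidden₀? (orbit t)

  Table : ℕ → ℕ → Set
  Table n c = Vec (Vec (List (Fin c)) n) n

  _⟨_,_⟩ : ∀ {n c} → Table n c → Fin n → Fin n → List (Fin c)
  D ⟨ u , v ⟩ = lookup (lookup D u) v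

  table : ∀ {n c} → (Fin n → Fin n → List (Fin c)) → Table n c
  table f = tabulate λ u → tabulate (f u)

  table-⟨⟩ : ∀ {n c} (f : Fin n → Fin n → List (Fin c)) u v → table f ⟨ u , v ⟩ ≡ f u v
  table-⟨⟩ f u v = trans (cong (λ row → lookup row v) (lookup∘tabulate (λ u → tabulate (f u)) u)) (lookup∘tabulate (f u) v)

  -- Path consistency: a candidate for (u, w) needs, for every third point `v`, candidates for (u,
  -- v) and (v, w) that complete an allowed triangle.
  Supported : ∀ {n c} → Table c c → Table n c → Fin n → Fin n → Pred (Fin c) 0ℓ
  Supported P D u w l = ∀ v → Any (λ i → Any (λ j → l ∈ P ⟨ i , j ⟩) (D ⟨ v , w ⟩)) (D ⟨ u , v ⟩)

  supported? : ∀ {n c} (P : Table c c) (D : Table n c) u w → Decidable (Supported P D u w)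
  supported? P D u w l = all? λ v → Any.any? (λ i → Any.any? (λ j → Any.any? (l F.≟_) (P ⟨ i , j ⟩)) (D ⟨ v , w ⟩)) (D ⟨ u , v ⟩)

  refine : ∀ {n c} → Table c c → Table n c → Table n c
  refine P D = table λ u w → filter (supported? P D u w) (D ⟨ u , w ⟩)

  refine⁴ : ∀ {n c} → Table c c → Table n c → Table n c
  refine⁴ P D = refine P (refine P (refine P (refine P D)))

  module Soundness {n c} (ρ : Fin n → Fin n → Fin c) (P : Table c c) (path : ∀ u v w → ρ u w ∈ P ⟨ ρ u v , ρ v w ⟩) where

    Sound : Table n c → Set
    Sound D = ∀ u v → ρ u v ∈ D ⟨ u , v ⟩

    refine-sound : ∀ D → Sound D → Sound (refine P D)
    refine-sound D sound u w = subst (ρ u w ∈_) (sym (table-⟨⟩ (λ u w → filter (supported? P D u w) (D ⟨ u , w ⟩)) u w))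
      (∈-filter⁺ (supported? P D u w) (sound u w) λ v → lose (sound u v) (lose (sound v w) (path u v w)))

    refine⁴-sound : ∀ D → Sound D → Sound (refine⁴ P D)
    refine⁴-sound D sound = refine-sound (refine P (refine P (refine P D))) (refine-sound (refine P (refine P D))
      (refine-sound (refine P D) (refine-sound D sound)))

  -- Upper bounds for the products R_iR_j; soundness needs no more than containment.
  products : Table 5 5
  products = table λ i j → filter (λ l → ¬? (forbidden? (l , i , j))) (allFin 5)

  Fact : Set
  Fact = Fin 13 × Fin 13 × Fin 5

  -- Under the isomorphism 1, 3, 9 are the points of R₂(0), and 9ν, 6ν, 7ν, -ν are the points chosen from such a ν.
  known : List Fact
  known = (0F , 9F , 2F) ∷ (0F , 3F , 2F) ∷ (3F , 9F , 3F) ∷ (0F , 1F , 2F) ∷ (1F , 3F , 3F) ∷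
    concatMap around (9F ∷ 3F ∷ 1F ∷ [])
    where
    around : Fin 13 → List Fact
    around ν = (0F , 6 · ν , 3F) ∷ (6 · ν , ν , 1F) ∷ (0F , 7 · ν , 1F) ∷ (7 · ν , ν , 1F) ∷ (0F , 12 · ν , 4F) ∷ (12 · ν , ν , 3F) ∷ []
      where
      _·_ : ℕ → Fin 13 → Fin 13
      m · ν = (m ℕ.* toℕ ν) mod 13

  reversed : Fact → Fact
  reversed (u , v , c) = v , u , star₅ c

  facts : List Fact
  facts = map (λ u → u , u , 0F) (allFin 13) ++ known ++ map reversed known

  Consistent : Fin 13 → Fin 13 → Pred (Fin 5) 0ℓ
  Consistent u v l = All (λ { (u′ , v′ , c) → u ≡ u′ → v ≡ v′ → l ≡ c }) facts

  consistent? : ∀ u v → Decidable (Consistent u v)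
  consistent? u v l = All.all? (λ { (u′ , v′ , c) → (u F.≟ u′) →-dec ((v F.≟ v′) →-dec (l F.≟ c)) }) facts

  initial : Table 13 5
  initial = table λ u v → filter (consistent? u v) (allFin 5)

  Solved : Table 13 5 → Set
  Solved D = ∀ u v → All (_≡ cyc u v) (D ⟨ u , v ⟩)

  solved? : ∀ D → Dec (Solved D)
  solved? D = all? λ u → all? λ v → All.all? (F._≟ cyc u v) (D ⟨ u , v ⟩)

  -- Four rounds suffice, which is checked by evaluation. `All` would also accept an empty list;
  -- that the right candidate is present follows from soundness.
  solved : Solved (refine⁴ products initial)
  solved = toWitness {a? = solved? (refine⁴ products initial)} tt

  -- The 13 labels may a priori name coinciding points: `0F` is a candidate for every pair without a
  -- fact, and propagation has to eliminate it.
  module Reconstruction (ρ : Fin 13 → Fin 13 → Fin 5)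
    (diagonal : ∀ u → ρ u u ≡ 0F) (antisym : ∀ u v → ρ v u ≡ star₅ (ρ u v))
    (path : ∀ u v w → ¬ Forbidden (ρ u w , ρ u v , ρ v w))
    (holds : All (λ { (u , v , c) → ρ u v ≡ c }) known)
    where

    path-product : ∀ u v w → ρ u w ∈ products ⟨ ρ u v , ρ v w ⟩
    path-product u v w = subst (ρ u w ∈_)
      (sym (table-⟨⟩ (λ i j → filter (λ l → ¬? (forbidden? (l , i , j))) (allFin 5)) (ρ u v) (ρ v w)))
      (∈-filter⁺ (λ l → ¬? (forbidden? (l , ρ u v , ρ v w))) (∈-allFin (ρ u w)) (path u v w))

    open Soundness ρ products path-product

    facts-hold : All (λ { (u , v , c) → ρ u v ≡ c }) facts
    facts-hold = ++⁺ (map⁺ (All.universal diagonal (allFin 13))) (++⁺ holds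
      (map⁺ (All.map (λ { {u , v , c} eq → trans (antisym u v) (cong star₅ eq) }) holds)))

    initial-sound : Sound initial
    initial-sound u v = subst (ρ u v ∈_) (sym (table-⟨⟩ (λ u v → filter (consistent? u v) (allFin 5)) u v))
      (∈-filter⁺ (consistent? u v) (∈-allFin (ρ u v)) (All.map (λ { eq refl refl → eq }) facts-hold))

    reconstruct : ∀ u v → ρ u v ≡ cyc u v
    reconstruct u v = All.lookup (solved u v) (refine⁴-sound initial initial-sound u v)

-- The classification

module Classification where
  open FiniteSums
  open SchemeTheory
  open Arithmetic
  open import Data.Nat using (ℕ; zero; suc; _+_; _*_; _≤_; _<_; ≢-nonZero)
  open import Data.Nat.Properties
  open import Data.Nat.Tactic.RingSolver using (solve-∀)
  import Data.Nat.ListAction as L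
  open import Data.Fin.Patterns
  open import Data.Fin.Properties using (cantor-schröder-bernstein)
  open import Data.List using (List; []; _∷_; map; lookup)
  open import Data.List.Membership.Propositional using (_∈_; _∉_)
  open import Data.List.Membership.DecPropositional using () renaming (_∈?_ to mem?)
  open import Data.List.Relation.Unary.Any as Any using (Any; here; there; index)
  open import Data.List.Relation.Unary.Any.Properties using (lookup-index; ++⁻)
  open import Data.List.Relation.Unary.All using (All; []; _∷_)
  open import Data.List.Relation.Unary.AllPairs using ([]; _∷_)
  open import Data.List.Relation.Unary.Unique.Propositional using (Unique)
  open import Data.Product using (∃-syntax; _×_; _,_; proj₁; proj₂)
  open import Data.Sum using (_⊎_; inj₁; inj₂)
  open import Data.Empty using (⊥; ⊥-elim)
  open import Function using (_∘_)
  open import Function.Bundles using (mk⤖; mk⇔; Equivalence)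
  open import Function.Consequences.Propositional using (strictlySurjective⇒surjective)
  open import Relation.Nullary using (¬_; yes; no; contradiction)
  open import Relation.Nullary.Decidable using (decidable-stable)
  open Traces using (module BoseMesnerTraces)
  open Cyclotomic
  open import Relation.Binary.PropositionalEquality

  toℕ-distinct : ∀ {n} {i j : Fin n} → toℕ i ≡ 1 → toℕ j ≡ 2 → i ≢ j
  toℕ-distinct i≡1 j≡2 refl = contradiction (trans (sym i≡1) j≡2) λ ()

  module Configuration {n d : ℕ} (S : Scheme n d) (comm : Scheme.Commutative S)
    (one two : Fin (suc d)) (one≢two : one ≢ two)
    (one*≢one : Scheme.star S one ≢ one)
    (generates : Scheme.Generates S one)
    (square : ∀ l → Scheme._∈_·_ S l one one →
      l ≡ one ⊎ l ≡ Scheme.star S one ⊎ l ≡ two)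
    (norm : ∀ l → Scheme._∈_·_ S l one (Scheme.star S one) →
      l ≡ F.zero ⊎ l ≡ one ⊎ l ≡ Scheme.star S one ⊎ l ≡ two ⊎ l ≡ Scheme.star S two)
    (two≢one* : two ≢ Scheme.star S one) (two≢two* : two ≢ Scheme.star S two)
    (k₁≡k₂ : Scheme.k S one ≡ Scheme.k S two) (1<k₁ : 1 < Scheme.k S one)
    where
    open Scheme S renaming (_∈_·_ to _∈ₛ_·_)
    open SchemeProperties S
    open ≡-Reasoning

    one* two* : Fin (suc d)
    one* = star one
    two* = star two

    κ : ℕ
    κ = k one

    star-injective : ∀ {i j} → star i ≡ star j → i ≡ j
    star-injective eq = trans (sym (star-involutive _)) (trans (cong star eq) (star-involutive _))

    star-swap : ∀ {i j} → star i ≡ j → i ≡ star j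
    star-swap eq = trans (sym (star-involutive _)) (cong star eq)

    one≢zero : one ≢ F.zero
    one≢zero refl = one*≢one star-zero

    two≢zero : two ≢ F.zero
    two≢zero refl = two≢two* (sym star-zero)

    one*≢zero : one* ≢ F.zero
    one*≢zero eq = one≢zero (trans (star-swap eq) star-zero)

    two*≢zero : two* ≢ F.zero
    two*≢zero eq = two≢zero (trans (star-swap eq) star-zero)

    relations : List (Fin (suc d))
    relations = F.zero ∷ one ∷ one* ∷ two ∷ two* ∷ []

    relations-unique : Unique relations
    relations-unique =
      (one≢zero ∘ sym ∷ one*≢zero ∘ sym ∷ two≢zero ∘ sym ∷ two*≢zero ∘ sym ∷ []) ∷
      (one*≢one ∘ sym ∷ one≢two ∷ two≢one* ∘ star-swap ∘ sym ∷ []) ∷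
      (two≢one* ∘ sym ∷ one≢two ∘ star-injective ∷ []) ∷
      (two≢two* ∷ []) ∷ [] ∷ []

    pattern in₀  = here refl
    pattern in₁  = there (here refl)
    pattern in₁* = there (there (here refl))
    pattern in₂  = there (there (there (here refl)))
    pattern in₂* = there (there (there (there (here refl))))

    relations-star : ∀ {l} → l ∈ relations → star l ∈ relations
    relations-star in₀  = here star-zero
    relations-star in₁  = in₁*
    relations-star in₁* = there (here (star-involutive one))
    relations-star in₂  = in₂*
    relations-star in₂* = there (there (there (here (star-involutive two))))

    ∉-star : ∀ {l} → l ∉ relations → star l ∉ relations
    ∉-star l∉ l*∈ = l∉ (subst (_∈ relations) (star-involutive _) (relations-star l*∈))

    square⊆ : ∀ {l} → l ∈ₛ one · one → l ∈ relations
    square⊆ l∈ with square _ l∈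
    ... | inj₁ refl        = in₁
    ... | inj₂ (inj₁ refl) = in₁*
    ... | inj₂ (inj₂ refl) = in₂

    norm⊆ : ∀ {l} → l ∈ₛ one · one* → l ∈ relations
    norm⊆ l∈ with norm _ l∈
    ... | inj₁ refl                      = in₀
    ... | inj₂ (inj₁ refl)               = in₁
    ... | inj₂ (inj₂ (inj₁ refl))        = in₁*
    ... | inj₂ (inj₂ (inj₂ (inj₁ refl))) = in₂
    ... | inj₂ (inj₂ (inj₂ (inj₂ refl))) = in₂*

    ≡0 : ∀ {l i j} → ¬ (l ∈ₛ i · j) → p l i j ≡ 0
    ≡0 = decidable-stable (_ ≟ 0)

    square-zero : ∀ {l} → l ≢ one → l ≢ one* → l ≢ two → p l one one ≡ 0
    square-zero ≢1 ≢1* ≢2 = ≡0 λ l∈ → case (square _ l∈)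
      where
      case : _ → ⊥
      case (inj₁ eq)        = ≢1 eq
      case (inj₂ (inj₁ eq)) = ≢1* eq
      case (inj₂ (inj₂ eq)) = ≢2 eq

    square-zero-outer : ∀ {l} → l ∉ relations → p l one one ≡ 0
    square-zero-outer l∉ = ≡0 (l∉ ∘ square⊆)

    norm-zero-outer : ∀ {l} → l ∉ relations → p l one one* ≡ 0
    norm-zero-outer l∉ = ≡0 (l∉ ∘ norm⊆)

    p-star : ∀ l i j → p (star l) (star i) (star j) ≡ p l i j
    p-star l i j = trans (p-transpose l j i) (comm l j i)

    p-star′ : ∀ l i j → p (star l) (star i) j ≡ p l i (star j)
    p-star′ l i j = trans (cong (p (star l) (star i)) (sym (star-involutive j))) (p-star l i (star j))

    k-star : ∀ i → k (star i) ≡ k i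
    k-star i = trans (comm F.zero (star i) (star (star i))) (cong (λ j → p F.zero j (star i)) (star-involutive i))

    -- Equal valencies cancel from the triangle count; in this way k₁ = k₂ expresses all the
    -- relevant numbers by a, b, c, f, g, h.
    p-shift : ∀ {l i} j → k l ≡ k i → p l i j ≡ p i l (star j)
    p-shift {l} {i} j kl≡ki = *-cancelˡ-≡ _ _ (k l) {{≢-nonZero (valency-pos l)}}
      (trans (p-shift-weighted l i j) (cong (_* p i l (star j)) (sym kl≡ki)))

    p-shift-star : ∀ {l i} j → k l ≡ k i → p l i (star j) ≡ p i l j
    p-shift-star j kl≡ki = trans (p-shift (star j) kl≡ki) (cong (p _ _) (star-involutive j))

    p-shift-zero : ∀ {l i j} → p i l (star j) ≡ 0 → p l i j ≡ 0
    p-shift-zero {l} {i} {j} eq = *-cancelˡ-≡ _ _ (k l) {{≢-nonZero (valency-pos l)}}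
      (trans (p-shift-weighted l i j) (trans (cong (k i *_) eq) (trans (*-zeroʳ (k i)) (sym (*-zeroʳ (k l))))))

    p-shift-zero-star : ∀ {l i j} → p i l j ≡ 0 → p l i (star j) ≡ 0
    p-shift-zero-star eq = p-shift-zero (trans (cong (p _ _) (star-involutive _)) eq)

    -- The parameters and the equations between them

    a b c f g h : ℕ
    a = p one one one
    b = p one* one one
    c = p two one one
    f = p two one one*
    g = p two one two
    h = p two one two*

    u : ℕ
    u = sum (off relations (p two one))

    -- In names such as p1-12* the superscript comes first: p¹₁₂*.
    p1-11* : p one one one* ≡ a
    p1-11* = p-shift-star one refl

    p1*-11* : p one* one one* ≡ a
    p1*-11* = trans (comm one* one one*) (trans (p-star′ one one one) p1-11*)

    p1-1*1* : p one one* one* ≡ b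
    p1-1*1* = trans (cong (λ l → p l one* one*) (sym (star-involutive one))) (p-star one* one one)

    p1-12 : p one one two ≡ f
    p1-12 = trans (comm one one two) (p-shift one k₁≡k₂)

    p2*-11* : p two* one one* ≡ f
    p2*-11* = trans (comm two* one one*) (p-star′ two one one)

    p1-12* : p one one two* ≡ f
    p1-12* = trans (comm one one two*) (trans (p-shift one (trans k₁≡k₂ (sym (k-star two)))) p2*-11*)

    p1-21* : p one two one* ≡ c
    p1-21* = p-shift-star one k₁≡k₂

    p2*-11 : p two* one one ≡ 0
    p2*-11 = square-zero (two≢one* ∘ star-swap) (one≢two ∘ star-injective ∘ sym) (two≢two* ∘ sym)

    p2-1*1* : p two one* one* ≡ 0
    p2-1*1* = trans (cong (λ l → p l one* one*) (sym (star-involutive two))) (trans (p-star two* one one) p2*-11)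

    p2-21* : p two two one* ≡ g
    p2-21* = trans (p-shift-star one refl) (comm two two one)

    p0-11 : p F.zero one one ≡ 0
    p0-11 = square-zero (one≢zero ∘ sym) (one*≢zero ∘ sym) (two≢zero ∘ sym)

    row* : κ ≡ a + b + c
    row* = begin
      κ                                                                       ≡⟨ k-star one ⟨
      k one*                                                                  ≡⟨ p-row one one* ⟨
      sum (p one one*)                                                        ≡⟨ sum-supported relations-unique (p one one*) outer ⟩
      p one one* F.zero + (p one one* one + (p one one* one* + (p one one* two + (p one one* two* + 0))))
        ≡⟨ cong₂ _+_ (p-zeroʳ-≢ (one*≢one ∘ sym)) (cong₂ _+_ (trans (comm one one* one) p1-11*) (cong₂ _+_ p1-1*1*
             (cong₂ _+_ (trans (comm one one* two) p1-21*) (cong (_+ 0) (trans (comm one one* two*) (p-shift-zero-star p2*-11)))))) ⟩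
      0 + (a + (b + (c + (0 + 0))))                                           ≡⟨ ring a b c ⟩
      a + b + c                                                               ∎
      where
      outer : ∀ i → i ∉ relations → p one one* i ≡ 0
      outer i i∉ = trans (comm one one* i) (p-shift-zero-star (square-zero-outer i∉))
      ring : ∀ a b c → 0 + (a + (b + (c + (0 + 0)))) ≡ a + b + c
      ring = solve-∀

    row : κ ≡ 1 + (a + a + f + f)
    row = begin
      κ                                ≡⟨ p-row one one ⟨
      sum (p one one)                  ≡⟨ sum-supported relations-unique (p one one) outer ⟩
      p one one F.zero + (a + (p one one one* + (p one one two + (p one one two* + 0))))
        ≡⟨ cong₂ _+_ (p-zeroʳ one) (cong (a +_) (cong₂ _+_ p1-11* (cong₂ _+_ p1-12 (cong (_+ 0) p1-12*)))) ⟩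
      1 + (a + (a + (f + (f + 0))))    ≡⟨ ring a f ⟩
      1 + (a + a + f + f)              ∎
      where
      outer : ∀ i → i ∉ relations → p one one i ≡ 0
      outer i i∉ = trans (comm one one i) (p-shift-zero (norm-zero-outer i∉))
      ring : ∀ a f → 1 + (a + (a + (f + (f + 0)))) ≡ 1 + (a + a + f + f)
      ring = solve-∀

    row₂ : κ ≡ c + f + g + h + u
    row₂ = begin
      κ                                            ≡⟨ p-row two one ⟨
      sum (p two one)                              ≡⟨ sum-split relations-unique (p two one) ⟩
      p two one F.zero + (c + (f + (g + (h + 0)))) + u ≡⟨ cong (λ x → x + (c + (f + (g + (h + 0)))) + u) (p-zeroʳ-≢ (one≢two ∘ sym)) ⟩
      0 + (c + (f + (g + (h + 0)))) + u            ≡⟨ ring c f g h u ⟩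
      c + f + g + h + u                            ∎
      where
      ring : ∀ c f g h u → 0 + (c + (f + (g + (h + 0)))) + u ≡ c + f + g + h + u
      ring = solve-∀

    -- Coefficient of A_l in (A₁A₁)A₁* = A₁(A₁A₁*).
    assoc : ∀ l → a * p l one one* + b * p l one* one* + c * p l two one*
          ≡ κ * p l one F.zero + a * p l one one + a * p l one one* + f * p l one two + f * p l one two*
    assoc l = begin
      a * p l one one* + b * p l one* one* + c * p l two one*
        ≡⟨ ring₁ (a * p l one one*) (b * p l one* one*) (c * p l two one*) ⟩
      0 + (a * p l one one* + (b * p l one* one* + (c * p l two one* + (0 + 0))))
        ≡⟨ cong₂ _+_ (cong (_* p l F.zero one*) p0-11) (cong (λ x → a * p l one one* + (b * p l one* one* + (c * p l two one* + (x * p l two* one* + 0)))) p2*-11) ⟨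
      L.sum (map (λ m → p m one one * p l m one*) relations)
        ≡⟨ sum-supported relations-unique _ (λ m m∉ → cong (_* p l m one*) (square-zero-outer m∉)) ⟨
      sum (λ m → p m one one * p l m one*)
        ≡⟨ p-assoc one one one* l ⟩
      sum (λ m → p m one one* * p l one m)
        ≡⟨ sum-supported relations-unique _ (λ m m∉ → cong (_* p l one m) (norm-zero-outer m∉)) ⟩
      κ * p l one F.zero + (p one one one* * p l one one + (p one* one one* * p l one one* + (f * p l one two + (p two* one one* * p l one two* + 0))))
        ≡⟨ cong (κ * p l one F.zero +_) (cong₂ _+_ (cong (_* p l one one) p1-11*) (cong₂ _+_ (cong (_* p l one one*) p1*-11*)
             (cong (λ x → f * p l one two + (x * p l one two* + 0)) p2*-11*))) ⟩
      κ * p l one F.zero + (a * p l one one + (a * p l one one* + (f * p l one two + (f * p l one two* + 0))))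
        ≡⟨ ring₂ (κ * p l one F.zero) (a * p l one one) (a * p l one one*) (f * p l one two) (f * p l one two*) ⟩
      κ * p l one F.zero + a * p l one one + a * p l one one* + f * p l one two + f * p l one two* ∎
      where
      ring₁ : ∀ x y z → x + y + z ≡ 0 + (x + (y + (z + (0 + 0))))
      ring₁ = solve-∀
      ring₂ : ∀ x y z w v → x + (y + (z + (w + (v + 0)))) ≡ x + y + z + w + v
      ring₂ = solve-∀

    assoc₁ : a * a + b * b + c * c ≡ κ + a * a + a * a + f * f + f * f
    assoc₁ = begin
      a * a + b * b + c * c
        ≡⟨ cong₂ _+_ (cong₂ _+_ (cong (a *_) p1-11*) (cong (b *_) p1-1*1*)) (cong (c *_) p1-21*) ⟨
      a * p one one one* + b * p one one* one* + c * p one two one*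
        ≡⟨ assoc one ⟩
      κ * p one one F.zero + a * a + a * p one one one* + f * p one one two + f * p one one two*
        ≡⟨ cong₂ _+_ (cong₂ _+_ (cong₂ _+_ (cong (_+ a * a) (trans (cong (κ *_) (p-zeroʳ one)) (*-identityʳ κ))) (cong (a *_) p1-11*)) (cong (f *_) p1-12)) (cong (f *_) p1-12*) ⟩
      κ + a * a + a * a + f * f + f * f ∎

    assoc₂ : a * f + c * g ≡ a * c + a * f + f * g + f * h
    assoc₂ = begin
      a * f + c * g
        ≡⟨ cong (_+ c * g) (trans (sym (+-identityʳ _)) (cong (a * f +_) (sym (*-zeroʳ b)))) ⟩
      a * f + b * 0 + c * g
        ≡⟨ cong₂ (λ x y → a * f + b * x + c * y) p2-1*1* p2-21* ⟨
      a * f + b * p two one* one* + c * p two two one*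
        ≡⟨ assoc two ⟩
      κ * p two one F.zero + a * c + a * f + f * g + f * h
        ≡⟨ cong (λ x → x + a * c + a * f + f * g + f * h) (trans (cong (κ *_) (p-zeroʳ-≢ (one≢two ∘ sym))) (*-zeroʳ κ)) ⟩
      a * c + a * f + f * g + f * h ∎

    -- Outside the five relations A₁², A₁A₁* and A₁*² have coefficient 0, so only products with A₂
    -- or A₂* survive in `assoc`.
    assoc-outer : ∀ {l} → l ∉ relations → c * p l two one* ≡ f * p l one two + f * p l one two*
    assoc-outer {l} l∉ = begin
      c * p l two one*
        ≡⟨ cong₂ (λ x y → x + y + c * p l two one*) (trans (cong (a *_) (norm-zero-outer l∉)) (*-zeroʳ a)) (trans (cong (b *_) 1*1*-outer) (*-zeroʳ b)) ⟨
      a * p l one one* + b * p l one* one* + c * p l two one*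
        ≡⟨ assoc l ⟩
      κ * p l one F.zero + a * p l one one + a * p l one one* + f * p l one two + f * p l one two*
        ≡⟨ cong (λ x → x + f * p l one two + f * p l one two*) (cong₂ _+_ (cong₂ _+_ (trans (cong (κ *_) (p-zeroʳ-≢ λ { refl → l∉ in₁ })) (*-zeroʳ κ))
             (trans (cong (a *_) (square-zero-outer l∉)) (*-zeroʳ a))) (trans (cong (a *_) (norm-zero-outer l∉)) (*-zeroʳ a))) ⟩
      f * p l one two + f * p l one two* ∎
      where
      1*1*-outer : p l one* one* ≡ 0
      1*1*-outer = trans (cong (λ l → p l one* one*) (sym (star-involutive l))) (trans (p-star (star l) one one) (square-zero-outer (∉-star l∉)))

    -- Exclusion of the degenerate cases

    open Parameters {a} {b} {c} {f} {g} {h} {u} {κ} row* row row₂ assoc₁ assoc₂ public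

    -- By `b*c`, c = 0 forces f = 0, so neither R₁² nor R₁R₁* reaches R₂ or R₂*.
    initial-closed : c ≡ 0 → Closed (_∈ (F.zero ∷ one ∷ one* ∷ []))
    initial-closed c≡0 = closed
      where
      square₀ : ∀ {l} → l ∈ₛ one · one → l ∈ (F.zero ∷ one ∷ one* ∷ [])
      square₀ l∈ with square _ l∈
      ... | inj₁ refl        = in₁
      ... | inj₂ (inj₁ refl) = in₁*
      ... | inj₂ (inj₂ refl) = contradiction c≡0 l∈
      norm₀ : ∀ {l} → l ∈ₛ one · one* → l ∈ (F.zero ∷ one ∷ one* ∷ [])
      norm₀ l∈ with norm _ l∈
      ... | inj₁ refl                      = in₀
      ... | inj₂ (inj₁ refl)               = in₁
      ... | inj₂ (inj₂ (inj₁ refl))        = in₁*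
      ... | inj₂ (inj₂ (inj₂ (inj₁ refl))) = contradiction (c≡0⇒f≡0 c≡0) l∈
      ... | inj₂ (inj₂ (inj₂ (inj₂ refl))) = contradiction (trans p2*-11* (c≡0⇒f≡0 c≡0)) l∈
      star₀ : ∀ {l} → l ∈ (F.zero ∷ one ∷ one* ∷ []) → star l ∈ (F.zero ∷ one ∷ one* ∷ [])
      star₀ in₀  = here star-zero
      star₀ in₁  = in₁*
      star₀ in₁* = there (here (star-involutive one))
      unstar₀ : ∀ {l} → star l ∈ (F.zero ∷ one ∷ one* ∷ []) → l ∈ (F.zero ∷ one ∷ one* ∷ [])
      unstar₀ l*∈ = subst (_∈ (F.zero ∷ one ∷ one* ∷ [])) (star-involutive _) (star₀ l*∈)
      product : ∀ {i j l} → i ∈ (F.zero ∷ one ∷ one* ∷ []) → j ∈ (F.zero ∷ one ∷ one* ∷ []) → l ∈ₛ i · j → l ∈ (F.zero ∷ one ∷ one* ∷ [])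
      product {i} {j} {l} i∈ in₀ l∈ = subst (_∈ (F.zero ∷ one ∷ one* ∷ [])) (sym (decidable-stable (l F.≟ i) (l∈ ∘ p-zeroʳ-≢))) i∈
      product {i} {j} {l} in₀ j∈ l∈ = subst (_∈ (F.zero ∷ one ∷ one* ∷ [])) (sym (decidable-stable (l F.≟ j) λ l≢j → l∈ (trans (comm l F.zero j) (p-zeroʳ-≢ l≢j)))) j∈
      product in₁  in₁  l∈ = square₀ l∈
      product in₁  in₁* l∈ = norm₀ l∈
      product {l = l} in₁* in₁  l∈ = norm₀ (l∈ ∘ trans (comm l one* one))
      product {l = l} in₁* in₁* l∈ = unstar₀ (square₀ (l∈ ∘ trans (trans (cong (λ l → p l one* one*) (sym (star-involutive l))) (p-star (star l) one one))))
      closed : Closed (_∈ (F.zero ∷ one ∷ one* ∷ []))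
      closed i j l i∈ j∈ l∈ = product (star₀ i∈) j∈ l∈

    c≢0 : c ≢ 0
    c≢0 c≡0 with generates (_∈ (F.zero ∷ one ∷ one* ∷ [])) (initial-closed c≡0) in₁ two
    ... | here eq                 = two≢zero eq
    ... | there (here eq)         = one≢two (sym eq)
    ... | there (there (here eq)) = two≢one* eq

    -- If f = 0, then b = 0 by `b*c`, so R₁ has no directed 3-cycle, and distinct points of R₁(x)
    -- are joined by R₁ or R₁* only. Then `transitive-regular` gives a = 0, whence κ = 1.
    f≢0 : f ≢ 0
    f≢0 f≡0 = <-irrefl (sym κ≡1) 1<k₁
      where
      tournament : ∀ l → l ∈ₛ one* · one → l ≡ F.zero ⊎ l ≡ one ⊎ l ≡ one*
      tournament l l∈ with norm l (l∈ ∘ trans (comm l one* one))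
      ... | inj₁ eq                          = inj₁ eq
      ... | inj₂ (inj₁ eq)                   = inj₂ (inj₁ eq)
      ... | inj₂ (inj₂ (inj₁ eq))            = inj₂ (inj₂ eq)
      ... | inj₂ (inj₂ (inj₂ (inj₁ refl)))   = contradiction (trans (comm two one* one) f≡0) l∈
      ... | inj₂ (inj₂ (inj₂ (inj₂ refl)))   = contradiction (trans (comm two* one* one) (trans p2*-11* f≡0)) l∈
      a≡0 : a ≡ 0
      a≡0 = trans (sym p1-11*) (transitive-regular one*≢one (f≡0⇒b≡0 c≢0 f≡0) tournament)
      κ≡1 : κ ≡ 1
      κ≡1 = trans row (cong₂ (λ a f → 1 + (a + a + f + f)) a≡0 f≡0)

    h≡0 : h ≡ 0
    h≡0 = proj₁ (dichotomy c≢0 f≢0)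

    -- The numerical conditions leave this case open; it would make R₂ a regular transitive tournament on R₁(x).
    module Degenerate (c≡f : c ≡ f) (a≡0 : a ≡ 0) (g≡0 : g ≡ 0) where
      tournament : ∀ l → l ∈ₛ one* · one → l ≡ F.zero ⊎ l ≡ two ⊎ l ≡ two*
      tournament l l∈ with norm l (l∈ ∘ trans (comm l one* one))
      ... | inj₁ eq                          = inj₁ eq
      ... | inj₂ (inj₁ refl)                 = contradiction (trans (comm one one* one) (trans p1-11* a≡0)) l∈
      ... | inj₂ (inj₂ (inj₁ refl))          = contradiction (trans (comm one* one* one) (trans p1*-11* a≡0)) l∈
      ... | inj₂ (inj₂ (inj₂ eq))            = inj₂ eq

      assoc-outer′ : ∀ {l} → l ∉ relations → p l two one* ≡ p l one two + p l one two*
      assoc-outer′ {l} l∉ = *-cancelˡ-≡ _ _ f {{≢-nonZero f≢0}}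
        (trans (cong (_* p l two one*) (sym c≡f)) (trans (assoc-outer l∉) (sym (*-distribˡ-+ f _ _))))

      -- Write w(l) = pˡ₁₂ and x(l) = pˡ₂₁*; transposing gives pˡ₁₂* = x(l*). Then `assoc-outer′` at
      -- l and at l* reads x(l) = w(l) + x(l*) and x(l*) = w(l*) + x(l), so w(l) + w(l*) = 0.
      12-outer : ∀ {l} → l ∉ relations → p l one two ≡ 0
      12-outer {l} l∉ = m+n≡0⇒n≡0 (p (star l) one two) (+-cancelʳ-≡ x _ _ (begin
        w′ + w + x                     ≡⟨ ring w′ w x ⟩
        w + (w′ + x)                   ≡⟨ cong (λ z → w + (w′ + z)) (trans (comm (star l) one two*) (p-star′ l two one)) ⟨
        w + (w′ + p (star l) one two*) ≡⟨ cong (w +_) (assoc-outer′ (∉-star l∉)) ⟨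
        w + p (star l) two one*        ≡⟨ cong (w +_) (trans (comm (star l) two one*) (p-star′ l one two)) ⟩
        w + p l one two*               ≡⟨ assoc-outer′ l∉ ⟨
        x                              ∎))
        where
        w w′ x : ℕ
        w = p l one two
        w′ = p (star l) one two
        x = p l two one*
        ring : ∀ w′ w x → w′ + w + x ≡ w + (w′ + x)
        ring = solve-∀

      -- In (A₁A₁)A₂ = A₁(A₁A₂) the coefficient of A₂* is at least c p²*₂₂ on the left, while every
      -- term on the right contains a vanishing factor.
      p2*-22 : p two* two two ≡ 0
      p2*-22 = *-cancelˡ-≡ _ _ c {{≢-nonZero c≢0}} (trans (n≤0⇒n≡0 (≤-trans (term≤sum (λ m → p m one one * p two* m two) two)
        (≤-reflexive (trans (p-assoc one one two two*) (sum-zero zeros))))) (sym (*-zeroʳ c)))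
        where
        zeros : ∀ m → p m one two * p two* one m ≡ 0
        zeros m with mem? F._≟_ m relations
        ... | no m∉   = cong (_* p two* one m) (12-outer m∉)
        ... | yes in₀  = trans (cong (p F.zero one two *_) (p-zeroʳ-≢ (two≢one* ∘ star-swap))) (*-zeroʳ (p F.zero one two))
        ... | yes in₁  = trans (cong (p one one two *_) p2*-11) (*-zeroʳ (p one one two))
        ... | yes in₁* = cong (_* p two* one one*) (trans (comm one* one two) (trans (p-shift one (trans (k-star one) k₁≡k₂)) p2-1*1*))
        ... | yes in₂  = cong (_* p two* one two) g≡0
        ... | yes in₂* = trans (cong (p two* one two *_) (trans p2*-12* g≡0)) (*-zeroʳ (p two* one two))
          where
          p2*-12* : p two* one two* ≡ g
          p2*-12* = trans (comm two* one two*) (trans (p-star′ two two one) p2-21*)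

      impossible : ⊥
      impossible = f≢0 (trans (sym p1-12*) (transitive-regular (two≢two* ∘ sym) p2*-22 tournament))

    -- Closure of the five relations and d = 4

    u≡0 : u ≡ 0
    u≡0 = case (proj₂ (dichotomy c≢0 f≢0))
      where
      case : u ≡ 0 ⊎ (c ≡ f × a ≡ 0 × g ≡ 0) → u ≡ 0
      case (inj₁ eq) = eq
      case (inj₂ (c≡f , a≡0 , g≡0)) = ⊥-elim (Degenerate.impossible c≡f a≡0 g≡0)

    -- Shifting the triangle turns pˡ₂₁* into p²₁ₗ up to valencies, which is one of the terms summed
    -- in `u`.
    21*-outer : ∀ {l} → l ∉ relations → p l two one* ≡ 0
    21*-outer {l} l∉ = p-shift-zero-star (trans (comm two l one) (n≤0⇒n≡0 (≤-trans
      (≤-reflexive (sym (off-∉ {xs = relations} (p two one) l∉)))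
      (≤-trans (term≤sum (off relations (p two one)) l) (≤-reflexive u≡0)))))

    -- For R₂ the left side of `assoc-outer` vanishes by `21*-outer`, hence so does f pˡ₁₂; R₂* is
    -- the transpose of `21*-outer`.
    one·-outer : ∀ {l m} → m ∈ relations → l ∉ relations → p l one m ≡ 0
    one·-outer {l} in₀ l∉ = p-zeroʳ-≢ λ { refl → l∉ in₁ }
    one·-outer in₁  l∉ = square-zero-outer l∉
    one·-outer in₁* l∉ = norm-zero-outer l∉
    one·-outer {l} in₂ l∉ = *-cancelˡ-≡ _ _ f {{≢-nonZero f≢0}} (trans (m+n≡0⇒m≡0 _ (trans (sym (assoc-outer l∉))
      (trans (cong (c *_) (21*-outer l∉)) (*-zeroʳ c)))) (sym (*-zeroʳ f)))
    one·-outer {l} in₂* l∉ = trans (sym (trans (comm (star l) two one*) (p-star′ l one two))) (21*-outer (∉-star l∉))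

    -- R₂ occurs in R₁², so products with R₂ are controlled by products with R₁.
    two·-outer : ∀ {l m} → m ∈ relations → l ∉ relations → p l two m ≡ 0
    two·-outer {l} {m} m∈ l∉ = *-cancelˡ-≡ _ _ c {{≢-nonZero c≢0}} (trans
      (n≤0⇒n≡0 (≤-trans (term≤sum (λ i → p i one one * p l i m) two)
        (≤-reflexive (trans (p-assoc one one m l) (sum-zero zeros)))))
      (sym (*-zeroʳ c)))
      where
      zeros : ∀ i → p i one m * p l one i ≡ 0
      zeros i with mem? F._≟_ i relations
      ... | yes i∈ = trans (cong (p i one m *_) (one·-outer i∈ l∉)) (*-zeroʳ (p i one m))
      ... | no  i∉ = cong (_* p l one i) (one·-outer m∈ i∉)

    ·-outer : ∀ {i l m} → i ∈ relations → m ∈ relations → l ∉ relations → p l i m ≡ 0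
    ·-outer {l = l} {m} in₀ m∈ l∉ = trans (comm l F.zero m) (p-zeroʳ-≢ λ { refl → l∉ m∈ })
    ·-outer in₁ m∈ l∉ = one·-outer m∈ l∉
    ·-outer in₂ m∈ l∉ = two·-outer m∈ l∉
    ·-outer {l = l} {m} in₁* m∈ l∉ = trans (unstar l m) (one·-outer (relations-star m∈) (∉-star l∉))
      where
      unstar : ∀ l m → p l one* m ≡ p (star l) one (star m)
      unstar l m = trans (cong (λ l → p l one* m) (sym (star-involutive l))) (p-star′ (star l) one m)
    ·-outer {l = l} {m} in₂* m∈ l∉ = trans (unstar l m) (two·-outer (relations-star m∈) (∉-star l∉))
      where
      unstar : ∀ l m → p l two* m ≡ p (star l) two (star m)
      unstar l m = trans (cong (λ l → p l two* m) (sym (star-involutive l))) (p-star′ (star l) two m)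

    relations-closed : Closed (_∈ relations)
    relations-closed i j l i∈ j∈ l∈ = decidable-stable (mem? F._≟_ l relations)
      (l∈ ∘ ·-outer (relations-star i∈) j∈)

    ∈-relations : ∀ i → i ∈ relations
    ∈-relations = generates (_∈ relations) relations-closed in₁

    -- The five relations reordered so that each position is the class of Cyc(13,4) that the
    -- relation corresponds to; transposition then becomes `star₅`.
    palette : List (Fin (suc d))
    palette = F.zero ∷ one ∷ two ∷ one* ∷ two* ∷ []

    palette-unique : Unique palette
    palette-unique =
      (one≢zero ∘ sym ∷ two≢zero ∘ sym ∷ one*≢zero ∘ sym ∷ two*≢zero ∘ sym ∷ []) ∷
      (one≢two ∷ one*≢one ∘ sym ∷ two≢one* ∘ star-swap ∘ sym ∷ []) ∷
      (two≢one* ∷ two≢two* ∷ []) ∷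
      (one≢two ∘ star-injective ∷ []) ∷ [] ∷ []

    ∈-palette : ∀ {i} → i ∈ relations → i ∈ palette
    ∈-palette in₀  = in₀
    ∈-palette in₁  = in₁
    ∈-palette in₁* = there (there (there (here refl)))
    ∈-palette in₂  = there (there (here refl))
    ∈-palette in₂* = in₂*

    colour : Fin 5 → Fin (suc d)
    colour = lookup palette

    σ : Fin (suc d) → Fin 5
    σ i = index (∈-palette (∈-relations i))

    colour-σ : ∀ i → colour (σ i) ≡ i
    colour-σ i = sym (lookup-index (∈-palette (∈-relations i)))

    colour-injective : ∀ {i j} → colour i ≡ colour j → i ≡ j
    colour-injective = lookup-injective palette-unique

    σ-colour : ∀ c → σ (colour c) ≡ c
    σ-colour c = colour-injective (colour-σ (colour c))

    σ-injective : ∀ {i j} → σ i ≡ σ j → i ≡ j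
    σ-injective {i} {j} eq = trans (sym (colour-σ i)) (trans (cong colour eq) (colour-σ j))

    d≡4 : d ≡ 4
    d≡4 = suc-injective (sym (cantor-schröder-bernstein {f = colour} {g = σ} colour-injective σ-injective))

    -- Parameters in the pseudocyclic case

    k≡κ : ∀ i → i ≢ F.zero → k i ≡ κ
    k≡κ i i≢0 with ∈-relations i
    ... | in₀  = contradiction refl i≢0
    ... | in₁  = refl
    ... | in₁* = k-star one
    ... | in₂  = sym k₁≡k₂
    ... | in₂* = trans (k-star two) (sym k₁≡k₂)

    sum-relations : ∀ (φ : Fin (suc d) → ℕ) → sum φ ≡ L.sum (map φ relations)
    sum-relations φ = sum-supported relations-unique φ λ i i∉ → contradiction (∈-relations i) i∉

    n≡1+4κ : n ≡ 1 + 4 * κ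
    n≡1+4κ = begin
      n                                                      ≡⟨ sum-valencies ⟨
      sum k                                                  ≡⟨ sum-relations k ⟩
      k F.zero + (κ + (k one* + (k two + (k two* + 0))))     ≡⟨ cong₂ (λ x y → x + (κ + (y + (k two + (k two* + 0))))) k-zero (k-star one) ⟩
      1 + (κ + (κ + (k two + (k two* + 0))))                 ≡⟨ cong₂ (λ x y → 1 + (κ + (κ + (x + (y + 0))))) (sym k₁≡k₂) (trans (k-star two) (sym k₁≡k₂)) ⟩
      1 + 4 * κ                                              ∎

    -- Sorted by the common relation this is the sum of the p¹ⱼ*ⱼ: R₁ and R₁* contribute a each, R₂
    -- and R₂* contribute g each.
    count-same-relation : ∀ {x y} → rel x y ≡ one → sum (λ z → 𝟙 (rel z x =ᶠ rel z y)) ≡ a + a + g + g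
    count-same-relation {x} {y} xy = begin
      sum (λ z → 𝟙 (rel z x =ᶠ rel z y))                     ≡⟨ sum-cong-≗ (λ z → sum-R (λ j → R j z x) z y) ⟨
      sum (λ z → sum (λ j → R j z x * R j z y))              ≡⟨ ∑-comm (λ z j → R j z x * R j z y) ⟩
      sum (λ j → sum (λ z → R j z x * R j z y))              ≡⟨ sum-cong-≗ (λ j → sum-cong-≗ λ z → cong (_* R j z y) (sym (R-star j z x))) ⟩
      sum (λ j → sum (λ z → R (star j) x z * R j z y))       ≡⟨ sum-cong-≗ (λ j → trans (paths (star j) j x y) (cong (λ l → p l (star j) j) xy)) ⟩
      sum (λ j → p one (star j) j)                           ≡⟨ sum-relations (λ j → p one (star j) j) ⟩
      p one (star F.zero) F.zero + (p one one* one + (p one (star one*) one* + (p one two* two + (p one (star two*) two* + 0))))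
        ≡⟨ cong₂ _+_ (p-zeroʳ-≢ (λ eq → one≢zero (trans eq star-zero))) (cong₂ _+_ (trans (comm one one* one) p1-11*)
             (cong₂ _+_ (trans (cong (λ i → p one i one*) (star-involutive one)) p1-11*)
             (cong₂ _+_ (trans (comm one two* two) p1-22*)
             (cong (_+ 0) (trans (cong (λ i → p one i two*) (star-involutive two)) p1-22*))))) ⟩
      0 + (a + (a + (g + (g + 0))))                          ≡⟨ ring a g ⟩
      a + a + g + g                                          ∎
      where
      p1-22* : p one two two* ≡ g
      p1-22* = sym (p-shift two (sym k₁≡k₂))
      ring : ∀ a g → 0 + (a + (a + (g + (g + 0)))) ≡ a + a + g + g
      ring = solve-∀

    pseudocyclic⇒values : Pseudocyclic S → a ≡ 0 × c ≡ 1 × f ≡ 1 × g ≡ 1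
    pseudocyclic⇒values (K , E , m , idempotents , ranks) with nonempty one
    ... | x , y , xy = pseudocyclic-values h≡0 u≡0 f≢0 (trans (cong suc (sym (count-same-relation xy)))
      (BoseMesnerTraces.pseudocyclic-count S K idempotents ranks k≡κ (λ eq → one≢zero (trans (sym xy) eq))))

    -- Uniqueness of the scheme on 13 points

    module Uniqueness (a≡0 : a ≡ 0) (c≡1 : c ≡ 1) (f≡1 : f ≡ 1) (g≡1 : g ≡ 1) where

      κ≡3 : κ ≡ 3
      κ≡3 = trans row (cong₂ (λ a f → 1 + (a + a + f + f)) a≡0 f≡1)

      n≡13 : n ≡ 13
      n≡13 = trans n≡1+4κ (cong (λ κ → 1 + 4 * κ) κ≡3)

      -- The numbers p²₂ⱼ sum to κ = 3, and R₀, R₁, R₁* already account for 1 each.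
      p2-22 : p two two two ≡ 0
      p2-22 = m+n≡0⇒m≡0 _ (+-cancelˡ-≡ 3 (p two two two + (p two two two* + 0)) 0 (begin
        3 + (p two two two + (p two two two* + 0))
          ≡⟨ cong₂ _+_ (p-zeroʳ two) (cong₂ _+_ (trans (comm two two one) g≡1) (cong (_+ (p two two two + (p two two two* + 0))) (trans p2-21* g≡1))) ⟨
        p two two F.zero + (p two two one + (p two two one* + (p two two two + (p two two two* + 0))))
          ≡⟨ sum-relations (p two two) ⟨
        sum (p two two)
          ≡⟨ p-row two two ⟩
        k two
          ≡⟨ trans (sym k₁≡k₂) κ≡3 ⟩
        3 ∎))

      -- The numbers p²₁*ⱼ sum to 3, of which R₁ and R₂ take 1 each and R₀ and R₁* nothing, so R₂*
      -- must occur.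
      p2-2*1* : p two two* one* ≢ 0
      p2-2*1* p≡0 = contradiction (begin
        2
          ≡⟨ cong₂ _+_ (p-zeroʳ-≢ two≢one*) (cong₂ _+_ (trans (comm two one* one) f≡1) (cong₂ _+_ p2-1*1*
               (cong₂ _+_ (trans (comm two one* two) (trans p2-21* g≡1)) (cong (_+ 0) (trans (comm two one* two*) p≡0))))) ⟨
        p two one* F.zero + (p two one* one + (p two one* one* + (p two one* two + (p two one* two* + 0))))
          ≡⟨ sum-relations (p two one*) ⟨
        sum (p two one*)
          ≡⟨ p-row two one* ⟩
        k one*
          ≡⟨ trans (k-star one) κ≡3 ⟩
        3 ∎) λ ()

      colour-star₅ : ∀ c → colour (star₅ c) ≡ star (colour c)
      colour-star₅ 0F = sym star-zero
      colour-star₅ 1F = refl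
      colour-star₅ 2F = refl
      colour-star₅ 3F = sym (star-involutive one)
      colour-star₅ 4F = sym (star-involutive two)

      σ-star : ∀ i → σ (star i) ≡ star₅ (σ i)
      σ-star i = colour-injective (trans (colour-σ (star i)) (trans (cong star (sym (colour-σ i))) (sym (colour-star₅ (σ i)))))

      Zero : Triple → Set
      Zero (l , i , j) = p (colour l) (colour i) (colour j) ≡ 0

      rotate-zero : ∀ t → Zero (rotate t) → Zero t
      rotate-zero (l , i , j) eq = p-shift-zero (trans (cong (p (colour i) (colour l)) (sym (colour-star₅ j))) eq)

      flip-zero : ∀ t → Zero (flip-ij t) → Zero t
      flip-zero (l , i , j) eq = trans (comm _ _ _) eq

      mirror-zero : ∀ t → Zero (mirror t) → Zero t
      mirror-zero (l , i , j) eq = trans (sym (p-star _ _ _)) (trans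
        (sym (cong₂ (λ f x → f x) (cong₂ p (colour-star₅ l) (colour-star₅ i)) (colour-star₅ j))) eq)

      rotations-zero : ∀ t → Any Zero (rotations t) → Zero t
      rotations-zero t (here eq)                                 = eq
      rotations-zero t (there (here eq))                         = flip-zero t eq
      rotations-zero t (there (there (here eq)))                 = rotate-zero t eq
      rotations-zero t (there (there (there (here eq))))         = flip-zero t (rotate-zero (flip-ij t) eq)
      rotations-zero t (there (there (there (there (here eq))))) = rotate-zero t (flip-zero (rotate t) eq)
      rotations-zero t (there (there (there (there (there (here eq)))))) =
        rotate-zero t (flip-zero (rotate t) (rotate-zero (flip-ij (rotate t)) eq))

      forbidden₀-zero : ∀ {t} → Forbidden₀ t → Zero t
      forbidden₀-zero (inj₁ (refl , l≢i)) = p-zeroʳ-≢ (l≢i ∘ colour-injective)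
      forbidden₀-zero (inj₂ (here refl)) = a≡0
      forbidden₀-zero (inj₂ (there (here refl))) = p2*-11
      forbidden₀-zero (inj₂ (there (there (here refl)))) = trans (sym (p-shift-star two (sym k₁≡k₂))) h≡0
      forbidden₀-zero (inj₂ (there (there (there (here refl))))) = p2-22

      forbidden-zero : ∀ t → Forbidden t → Zero t
      forbidden-zero t forb = case (++⁻ (rotations t) forb)
        where
        case : _ ⊎ _ → Zero t
        case (inj₁ forb) = rotations-zero t (Any.map forbidden₀-zero forb)
        case (inj₂ forb) = mirror-zero t (rotations-zero (mirror t) (Any.map forbidden₀-zero forb))

      path-allowed : ∀ x y z → ¬ Forbidden (σ (rel x z) , σ (rel x y) , σ (rel y z))
      path-allowed x y z forb = path-≢0 {z = y} (sym (colour-σ _)) (sym (colour-σ _)) (sym (colour-σ _))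
        (forbidden-zero _ forb)

      module Frame {x v₀ : Fin n} (xv₀ : rel x v₀ ≡ two) where

        next : ∀ {v} → rel x v ≡ two → ∃[ w ] (rel x w ≡ two × rel w v ≡ one*)
        next xv = path-∃ xv (λ eq → contradiction (trans (sym g≡1) (trans (sym p2-21*) eq)) λ ())

        α : ∀ {v} → rel x v ≡ two → ∃[ w ] (rel x w ≡ one* × rel w v ≡ one)
        α xv = path-∃ xv (f≢0 ∘ trans (comm two one one*))

        β : ∀ {v} → rel x v ≡ two → ∃[ w ] (rel x w ≡ one × rel w v ≡ one)
        β xv = path-∃ xv c≢0

        γ : ∀ {v} → rel x v ≡ two → ∃[ w ] (rel x w ≡ two* × rel w v ≡ one*)
        γ xv = path-∃ xv p2-2*1*

        -- In the model `next` is multiplication by 9, which has order 3 modulo 13. That `v₂` leads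
        -- back to `v₀` is left to the propagation.
        v₁ v₂ : ∃[ w ] rel x w ≡ two
        v₁ = proj₁ (next xv₀) , proj₁ (proj₂ (next xv₀))
        v₂ = proj₁ (next (proj₂ v₁)) , proj₁ (proj₂ (next (proj₂ v₁)))

        point : Fin 13 → Fin n
        point = lookup points
          where
          points : List (Fin n)
          -- Position r holds the point meant for the residue r, with `x` at 0 and v₀, v₁, v₂ at 9,
          -- 3, 1; `α`, `β`, `γ` multiply by 6, 7 and -1.
          points = x ∷ proj₁ v₂ ∷ proj₁ (α xv₀) ∷ proj₁ v₁ ∷ proj₁ (γ xv₀) ∷ proj₁ (α (proj₂ v₁)) ∷ proj₁ (α (proj₂ v₂)) ∷
            proj₁ (β (proj₂ v₂)) ∷ proj₁ (β (proj₂ v₁)) ∷ v₀ ∷ proj₁ (γ (proj₂ v₁)) ∷ proj₁ (β xv₀) ∷ proj₁ (γ (proj₂ v₂)) ∷ []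

        ρ : Fin 13 → Fin 13 → Fin 5
        ρ u v = σ (rel (point u) (point v))

        known-hold : All (λ { (u , v , c) → ρ u v ≡ c }) known
        known-hold =
          has xv₀ ∷ has (proj₂ v₁) ∷ second (next xv₀) refl ∷ has (proj₂ v₂) ∷ second (next (proj₂ v₁)) refl ∷
          first (α xv₀) refl ∷ second (α xv₀) refl ∷ first (β xv₀) refl ∷ second (β xv₀) refl ∷ first (γ xv₀) refl ∷ second (γ xv₀) refl ∷
          first (α (proj₂ v₁)) refl ∷ second (α (proj₂ v₁)) refl ∷ first (β (proj₂ v₁)) refl ∷ second (β (proj₂ v₁)) refl ∷ first (γ (proj₂ v₁)) refl ∷ second (γ (proj₂ v₁)) refl ∷
          first (α (proj₂ v₂)) refl ∷ second (α (proj₂ v₂)) refl ∷ first (β (proj₂ v₂)) refl ∷ second (β (proj₂ v₂)) refl ∷ first (γ (proj₂ v₂)) refl ∷ second (γ (proj₂ v₂)) refl ∷ []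
          where
          has : ∀ {y z c} → rel y z ≡ colour c → σ (rel y z) ≡ c
          has {c = c} eq = trans (cong σ eq) (σ-colour c)
          first : ∀ {y i j c} (q : ∃[ w ] (rel x w ≡ i × rel w y ≡ j)) → i ≡ colour c → σ (rel x (proj₁ q)) ≡ c
          first (_ , xw , _) eq = has (trans xw eq)
          second : ∀ {y i j c} (q : ∃[ w ] (rel x w ≡ i × rel w y ≡ j)) → j ≡ colour c → σ (rel (proj₁ q) y) ≡ c
          second (_ , _ , wy) eq = has (trans wy eq)

        ρ≡cyc : ∀ u v → ρ u v ≡ cyc u v
        ρ≡cyc = Reconstruction.reconstruct ρ
          (λ u → trans (cong σ (rel0' (point u))) (σ-colour 0F))
          (λ u v → trans (cong σ (transpose (point u) (point v))) (σ-star (rel (point u) (point v))))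
          (λ u v w → path-allowed (point u) (point v) (point w))
          known-hold

        -- Coinciding points are in relation R₀, but `cyc` takes the value 0 on the diagonal only.
        -- With n = 13 the chosen points then exhaust the scheme.
        point-injective : ∀ {u v} → point u ≡ point v → u ≡ v
        point-injective {u} {v} eq = cyc-zero u v (trans (sym (ρ≡cyc u v))
          (trans (cong σ (trans (cong (rel (point u)) (sym eq)) (rel0' (point u)))) (σ-colour 0F)))

        point-surjective : ∀ y → ∃[ u ] point u ≡ y
        point-surjective = injective⇒strictlySurjective (sym n≡13) point-injective

        locate : Fin n → Fin 13
        locate y = proj₁ (point-surjective y)

        point-locate : ∀ y → point (locate y) ≡ y
        point-locate y = proj₂ (point-surjective y)

        σ-rel : ∀ y z → cyc (locate y) (locate z) ≡ σ (rel y z)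
        σ-rel y z = trans (sym (ρ≡cyc (locate y) (locate z))) (cong₂ (λ y z → σ (rel y z)) (point-locate y) (point-locate z))

        isomorphism : IsoCyc13-4 S
        isomorphism =
          mk⤖ ((λ {y} {z} eq → trans (sym (point-locate y)) (trans (cong point eq) (point-locate z))) ,
               strictlySurjective⇒surjective (λ u → point u , point-injective (point-locate (point u)))) ,
          mk⤖ (σ-injective , strictlySurjective⇒surjective (λ c → colour c , σ-colour c)) ,
          λ y z i → mk⇔
            (λ eq → Equivalence.to (cyc⇔CycRel (locate y) (locate z) (σ i)) (trans (σ-rel y z) (cong σ eq)))
            (λ cr → σ-injective (trans (sym (σ-rel y z)) (Equivalence.from (cyc⇔CycRel (locate y) (locate z) (σ i)) cr)))

    pseudocyclic⇒IsoCyc13-4 : Pseudocyclic S → IsoCyc13-4 S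
    pseudocyclic⇒IsoCyc13-4 pseudocyclic =
      let a≡0 , c≡1 , f≡1 , g≡1 = pseudocyclic⇒values pseudocyclic
          x , v₀ , xv₀ = nonempty two
      in Uniqueness.Frame.isomorphism a≡0 c≡1 f≡1 g≡1 xv₀

theorem1p1 : ∀ {n d : ℕ} (S : Scheme n d) → Scheme.Commutative S → 2 ≤ d →
    (one two : Fin (suc d)) → toℕ one ≡ 1 → toℕ two ≡ 2 →
    Scheme.star S one ≢ one →
    Scheme.Generates S one →
    (∀ l → Scheme._∈_·_ S l one one →
    l ≡ one ⊎ l ≡ Scheme.star S one ⊎ l ≡ two) →
    (∀ l → Scheme._∈_·_ S l one (Scheme.star S one) →
    l ≡ F.zero ⊎ l ≡ one ⊎ l ≡ Scheme.star S one ⊎ l ≡ two ⊎ l ≡ Scheme.star S two) →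
    two ≢ Scheme.star S one → two ≢ Scheme.star S two →
    Scheme.k S one ≡ Scheme.k S two → 1 < Scheme.k S one →
    d ≡ 4 × (Pseudocyclic S → IsoCyc13-4 S)
theorem1p1 S comm _ one two one≡1 two≡2 one*≢one generates square norm two≢one* two≢two* k₁≡k₂ 1<k₁ =
  d≡4 , pseudocyclic⇒IsoCyc13-4
  where
  open Classification
  open Configuration S comm one two (toℕ-distinct one≡1 two≡2) one*≢one generates square norm two≢one* two≢two* k₁≡k₂ 1<k₁
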